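{- Up to renaming of the colors (by a bijection of alphabets), the minimal non-foot-sortable 2-bounded sock orderings are exactly the following $14$ sporadic sock orderings together with the members of the following $4$ infinite families. Sporadic sock orderings (distinct letters denote distinct colors): $abcdbacd$, $abcdedabc$; $abcadbdc$, $abcbdadc$, $abcdbadc$, $abcdcadb$, $abcdceaeb$, $abcdedacb$; $abcdbcad$, $abcdcbad$, $abcdedbac$; $abcabdedc$, $abcdadedc$, $abcdcaefeb$. Infinite families (where $x,y,z,a_0,a_1,\ldots,a_{n-1}$ denote pairwise distinct colors, and in each case the final part "$a_{n-2}a_{n-1}a_{n-3}a_{n-2}\cdots a_0a_1$" denotes the concatenation of the two-letter words $a_{i}a_{i+1}$ for $i=n-2,n-3,\ldots,0$ in this order): (A) $x\,a_0\,y\,a_{n-1}\,x\,a_{n-2}a_{n-1}a_{n-3}a_{n-2}\cdots a_0a_1$ for $n\ge 2$; (B) $a_0\,x\,y\,a_{n-1}\,x\,y\,a_{n-2}a_{n-1}a_{n-3}a_{n-2}\cdots a_0a_1$ for $n\ge 3$; (B') $a_0\,y\,x\,a_{n-1}\,x\,y\,a_{n-2}a_{n-1}a_{n-3}a_{n-2}\cdots a_0a_1$ for $n\ge 3$; (C) $a_0\,x\,a_{n-1}\,y\,z\,y\,x\,a_{n-2}a_{n-1}a_{n-3}a_{n-2}\cdots a_0a_1$ for $n\ge 3$.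
   Context: A sock ordering is a finite string $s_1s_2\cdots s_n$ of letters; each entry is a sock and its letter is its color. Sorting with a stack (one foot): the socks are read from left to right and each is pushed onto the top of a stack; at any time the top sock of the stack may be popped and appended to the output; at the end all socks have been output. A sock ordering is foot-sortable if the stack operations can be chosen so that in the output the socks of each color form a contiguous block. A sock ordering is 2-bounded if each color appears in it at most twice. A non-foot-sortable sock ordering is minimal if deleting any single sock makes it foot-sortable.
   Formalization: The printed sporadic ordering abcdadedc uses d three times and so is not 2-bounded; it is replaced by abcbadedc, with which the list is proved complete and correct. Colors are taken from any set with decidable equality. -}

module Defs where

open import Level using (Level)
open import Data.Nat using (ℕ; zero; suc; _∸_; _≤_)
open import Data.Fin using (Fin)
open import Data.List using (List; []; _∷_; _++_; _∷ʳ_; map; length; filter; removeAt)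
open import Data.List.Membership.Propositional using (_∈_)
open import Data.List.Relation.Unary.Grouped using (Grouped)
open import Data.Product using (_×_; ∃-syntax)
open import Data.Vec using (Vec; []; _∷_)
open import Relation.Binary.Construct.Closure.ReflexiveTransitive using (Star)
open import Relation.Binary.Definitions using (DecidableEquality)
open import Relation.Binary.PropositionalEquality using (_≡_)
open import Relation.Nullary using (¬_)

-- The head of the stack is its top; the last element of the output is the
-- sock that was output most recently.
record State {c : Level} (C : Set c) : Set c where
  constructor ⟨_,_,_⟩
  field
    input stack output : List C

data _⟶_ {c : Level} {C : Set c} : State C → State C → Set c where
  push : ∀ {s i st o} → ⟨ s ∷ i , st , o ⟩ ⟶ ⟨ i , s ∷ st , o ⟩
  pop  : ∀ {s i st o} → ⟨ i , s ∷ st , o ⟩ ⟶ ⟨ i , st , o ∷ʳ s ⟩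

FootSortable : {c : Level} {C : Set c} → List C → Set c
FootSortable s =
  ∃[ o ] Star _⟶_ ⟨ s , [] , [] ⟩ ⟨ [] , [] , o ⟩ × Grouped _≡_ o

MinimalNonFootSortable : {c : Level} {C : Set c} → List C → Set c
MinimalNonFootSortable s =
  ¬ FootSortable s × ((i : Fin (length s)) → FootSortable (removeAt s i))

2-Bounded : {c : Level} {C : Set c} → DecidableEquality C → List C → Set c
2-Bounded _≟_ s = ∀ x → length (filter (x ≟_) s) ≤ 2

-- The alphabet of an ordering is the set of colors occurring in it.  The map f
-- is injective on the alphabet of v and, as w is map f v, it is onto that of w;
-- it may do anything outside the alphabet of v.
_RenamesTo_ : {b c : Level} {B : Set b} {C : Set c} → List B → List C → Set _
_RenamesTo_ {B = B} {C = C} v w =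
  ∃[ f ] (∀ {x y : B} → x ∈ v → y ∈ v → f x ≡ f y → x ≡ y) × map {B = C} f v ≡ w

data SporadicColor : Set where
  a b c d e f : SporadicColor

-- In the word abcbadedc the fourth letter is b.  The variant abcdadedc, with
-- fourth letter d, uses d three times and so is not 2-bounded.
sporadic : Vec (List SporadicColor) 14
sporadic =
  (a ∷ b ∷ c ∷ d ∷ b ∷ a ∷ c ∷ d ∷ []) ∷
  (a ∷ b ∷ c ∷ d ∷ e ∷ d ∷ a ∷ b ∷ c ∷ []) ∷
  (a ∷ b ∷ c ∷ a ∷ d ∷ b ∷ d ∷ c ∷ []) ∷
  (a ∷ b ∷ c ∷ b ∷ d ∷ a ∷ d ∷ c ∷ []) ∷
  (a ∷ b ∷ c ∷ d ∷ b ∷ a ∷ d ∷ c ∷ []) ∷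
  (a ∷ b ∷ c ∷ d ∷ c ∷ a ∷ d ∷ b ∷ []) ∷
  (a ∷ b ∷ c ∷ d ∷ c ∷ e ∷ a ∷ e ∷ b ∷ []) ∷
  (a ∷ b ∷ c ∷ d ∷ e ∷ d ∷ a ∷ c ∷ b ∷ []) ∷
  (a ∷ b ∷ c ∷ d ∷ b ∷ c ∷ a ∷ d ∷ []) ∷
  (a ∷ b ∷ c ∷ d ∷ c ∷ b ∷ a ∷ d ∷ []) ∷
  (a ∷ b ∷ c ∷ d ∷ e ∷ d ∷ b ∷ a ∷ c ∷ []) ∷
  (a ∷ b ∷ c ∷ a ∷ b ∷ d ∷ e ∷ d ∷ c ∷ []) ∷
  (a ∷ b ∷ c ∷ b ∷ a ∷ d ∷ e ∷ d ∷ c ∷ []) ∷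
  (a ∷ b ∷ c ∷ d ∷ c ∷ a ∷ e ∷ f ∷ e ∷ b ∷ []) ∷
  []

data FamilyColor : Set where
  x y z : FamilyColor
  α     : ℕ → FamilyColor

-- αₙ₋₂αₙ₋₁ αₙ₋₃αₙ₋₂ ⋯ α₀α₁
descent : ℕ → List FamilyColor
descent zero          = []
descent (suc zero)    = []
descent (suc (suc k)) = α k ∷ α (suc k) ∷ descent (suc k)

familyA familyB familyB′ familyC : ℕ → List FamilyColor
familyA  n = x ∷ α 0 ∷ y ∷ α (n ∸ 1) ∷ x ∷ descent n
familyB  n = α 0 ∷ x ∷ y ∷ α (n ∸ 1) ∷ x ∷ y ∷ descent n
familyB′ n = α 0 ∷ y ∷ x ∷ α (n ∸ 1) ∷ x ∷ y ∷ descent n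
familyC  n = α 0 ∷ x ∷ α (n ∸ 1) ∷ y ∷ z ∷ y ∷ x ∷ descent n

{-# OPTIONS --safe #-}

-- Read a word from left to right.  A second sock either meets its partner on top
-- of the stack, or its partner has to leave the stack before ("is locked") and
-- nothing else may be output in between.  A greedy strategy outputs complete
-- colors at once and starts locks as late as possible.  The stack then consists of
-- all open colors, in the order of their first socks, and of complete colors
-- ("bullets") trapped between them.  If k is the color of the next second sock and
-- is not on top, then k must lie directly under the top color v, without a bullet
-- in between, only single socks may come before it, and the next second sock after
-- it must be that of v, which is then locked.  A failure of one of these conditions
-- exhibits one of the sporadic words or the family word A for n = 2, with the
-- exception of a bullet between k and v: a bullet between α₀ and αₖ₊₁ is handed down
-- to α₀ and αₖ by the two letters αₖαₖ₊₁, so tracing it back to its origin yields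
-- the families.  Thus a word that is not sortable contains a listed word, and it
-- remains to show that the listed words are minimal.
--
-- If no color occurs more than twice in a word, then every copy in it of a listed
-- word is automatically an injective renaming, because almost all letters of a
-- listed word occur twice.
module Submission where

open import Defs
open import Data.Bool using (Bool; true; false; _∧_; _∨_; T)
open import Data.Bool.Properties using (T-∧; T-∨; T?)
open import Data.Empty using (⊥; ⊥-elim)
open import Data.Fin as Fin using (Fin; zero; suc; #_)
open import Data.List using (List; []; _∷_; _++_; [_]; map; _ʳ++_; reverse; length; filter; removeAt)
open import Data.List.Membership.Propositional using (_∈_; _∉_; find; lose)
open import Data.List.Membership.Propositional.Properties using (∈-++⁺ˡ; ∈-++⁺ʳ; ∈-++⁻; ∈-map⁺; ∈-map⁻)
open import Data.List.Properties using (++-assoc; ++-identityʳ; map-++; map-∘; unfold-reverse; ∷-injectiveˡ; ∷-injectiveʳ; map-id; map-injective; filter-all)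
open import Data.List.Relation.Binary.Sublist.Propositional using (_⊆_; []; _∷_; _∷ʳ_; ⊆-refl; ⊆-reflexive; ⊆-trans; minimum; from∈; to∈)
open import Data.List.Relation.Binary.Sublist.Propositional.Properties using (++⁺; ++⁺ˡ; ++⁺ʳ; ∷ˡ⁻; Any-resp-⊆; reverse⁺; length-mono-≤; filter-⊆)
open import Data.List.Relation.Unary.All as All using (All; []; _∷_)
open import Data.List.Relation.Unary.Any as Any using (here; there)
open import Data.List.Relation.Unary.Grouped using (Grouped; []; _∷≉_; _∷≈_; grouped?)
open import Data.List.Relation.Unary.Linked using (Linked; []; [-]; _∷_)
open import Data.Maybe using (Maybe; just; nothing; is-just; _<∣>_)
open import Data.Nat using (ℕ; zero; suc; _≤_; _<_; _≥_; z≤n; s≤s; _∸_; s≤s⁻¹)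
open import Data.Nat.Properties as ℕ using (≤-refl; ≤-trans; n≤1+n)
open import Data.Product using (_×_; _,_; ∃-syntax; proj₁; proj₂)
open import Data.Sum using (_⊎_; inj₁; inj₂)
open import Data.Vec using (Vec; lookup; []; _∷_)
open import Data.Vec.Relation.Unary.Any as VecAny using (Any)
open import Function using (_∘_; case_of_)
open import Function.Bundles using (Equivalence; _⇔_; mk⇔)
open import Level using (Level)
open import Relation.Binary.Construct.Closure.ReflexiveTransitive using (Star; ε; _◅_; _◅◅_)
open import Relation.Binary.Definitions using (DecidableEquality)
open import Relation.Binary.PropositionalEquality using (_≡_; _≢_; refl; sym; trans; cong; subst)
open import Relation.Nullary using (¬_; yes; no; Dec)
open import Relation.Nullary.Decidable using (True; toWitness; map′; _⊎-dec_; ⌊_⌋; ¬?; from-yes; _×-dec_)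
import Data.Fin.Properties as Fin
import Data.List.Membership.DecPropositional as DecMembership
import Data.List.Relation.Binary.Sublist.Propositional.Properties as Sub
import Data.List.Relation.Unary.All.Properties as All
import Data.Vec.Relation.Unary.All as VecAll
import Data.Vec.Relation.Unary.All.Properties as VecAll

private variable
  ℓ ℓ′ : Level
  B : Set ℓ′
  C : Set ℓ
  i i′ st st′ o o′ l l′ us vs : List C
  p : C

-- Grouped words and deletion of socks

SandwichFree : {C : Set ℓ} → List C → Set ℓ
SandwichFree l = ∀ {p q} → p ∷ q ∷ p ∷ [] ⊆ l → p ≡ q

-- Avoiding a sandwich passes to subsequences, and a single sandwich refutes groupedness; outputs
-- are mostly handled in this form.
Grouped⇒SandwichFree : Grouped _≡_ l → SandwichFree l
Grouped⇒SandwichFree (≉l ∷≉ g) (refl ∷ s) = ⊥-elim (All.lookup ≉l (to∈ (∷ˡ⁻ s)) refl)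
Grouped⇒SandwichFree (≉l ∷≉ g) (_ ∷ʳ s) = Grouped⇒SandwichFree g s
Grouped⇒SandwichFree (refl ∷≈ g) (refl ∷ refl ∷ s) = refl
Grouped⇒SandwichFree (refl ∷≈ g) (refl ∷ _ ∷ʳ s) = Grouped⇒SandwichFree g (refl ∷ s)
Grouped⇒SandwichFree (p≈q ∷≈ g) (_ ∷ʳ s) = Grouped⇒SandwichFree g s

module _ {C : Set ℓ} (_≟_ : DecidableEquality C) where

  SandwichFree⇒Grouped : (l : List C) → SandwichFree l → Grouped _≡_ l
  SandwichFree⇒Grouped [] sf = []
  SandwichFree⇒Grouped (p ∷ []) sf = [] ∷≉ []
  SandwichFree⇒Grouped (p ∷ q ∷ l) sf with p ≟ q | SandwichFree⇒Grouped (q ∷ l) (λ s → sf (p ∷ʳ s))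
  ... | yes p≡q | g = p≡q ∷≈ g
  ... | no p≢q | g = (p≢q ∷ All.tabulate λ { r∈l refl → p≢q (sf (refl ∷ refl ∷ from∈ r∈l)) }) ∷≉ g

  Grouped-⊆ : {l l′ : List C} → l ⊆ l′ → Grouped _≡_ l′ → Grouped _≡_ l
  Grouped-⊆ s g = SandwichFree⇒Grouped _ λ t → Grouped⇒SandwichFree g (⊆-trans t s)

-- The moves of deleted socks are skipped. The other moves remain legal, and their output is a
-- subsequence of the old one.
Star-⊆ : Star _⟶_ ⟨ i′ , st′ , o′ ⟩ ⟨ [] , [] , l′ ⟩ → i ⊆ i′ → st ⊆ st′ → o ⊆ o′ →
  ∃[ l ] Star _⟶_ ⟨ i , st , o ⟩ ⟨ [] , [] , l ⟩ × l ⊆ l′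
Star-⊆ ε [] [] τ = _ , ε , τ
Star-⊆ (push ◅ r) (_ ∷ʳ ρ) σ τ = Star-⊆ r ρ (_ ∷ʳ σ) τ
Star-⊆ (push ◅ r) (refl ∷ ρ) σ τ with Star-⊆ r ρ (refl ∷ σ) τ
... | _ , r′ , υ = _ , push ◅ r′ , υ
Star-⊆ (pop ◅ r) ρ (_ ∷ʳ σ) τ = Star-⊆ r ρ σ (++⁺ʳ _ τ)
Star-⊆ (pop ◅ r) ρ (refl ∷ σ) τ with Star-⊆ r ρ σ (++⁺ τ ⊆-refl)
... | _ , r′ , υ = _ , pop ◅ r′ , υ

FootSortable-⊆ : {C : Set ℓ} → DecidableEquality C → {i i′ : List C} → i ⊆ i′ → FootSortable i′ → FootSortable i
FootSortable-⊆ _≟_ ρ (_ , r , g) with Star-⊆ r ρ [] []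
... | l , r′ , υ = l , r′ , Grouped-⊆ _≟_ υ g

-- Doubling a sock

data Stutter {C : Set ℓ} : List C → List C → Set ℓ where
  []     : Stutter [] []
  once   : ∀ {p} → Stutter l l′ → Stutter (p ∷ l) (p ∷ l′)
  twice  : ∀ {p} → Stutter l l′ → Stutter (p ∷ l) (p ∷ p ∷ l′)

Stutter-refl : (l : List C) → Stutter l l
Stutter-refl [] = []
Stutter-refl (p ∷ l) = once (Stutter-refl l)

Stutter-++ : Stutter i i′ → Stutter l l′ → Stutter (i ++ l) (i′ ++ l′)
Stutter-++ [] τ = τ
Stutter-++ (once σ) τ = once (Stutter-++ σ τ)
Stutter-++ (twice σ) τ = twice (Stutter-++ σ τ)

-- The two copies of a doubled sock move directly one after the other, so they stay adjacent in
-- input, stack and output.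
Star-Stutter : Star _⟶_ ⟨ i , st , o ⟩ ⟨ [] , [] , l ⟩ → Stutter i i′ → Stutter st st′ → Stutter o o′ →
  ∃[ l′ ] Star _⟶_ ⟨ i′ , st′ , o′ ⟩ ⟨ [] , [] , l′ ⟩ × Stutter l l′
Star-Stutter ε [] [] τ = _ , ε , τ
Star-Stutter (push ◅ r) (once ρ) σ τ with Star-Stutter r ρ (once σ) τ
... | _ , r′ , υ = _ , push ◅ r′ , υ
Star-Stutter (push ◅ r) (twice ρ) σ τ with Star-Stutter r ρ (twice σ) τ
... | _ , r′ , υ = _ , push ◅ push ◅ r′ , υ
Star-Stutter (pop ◅ r) ρ (once σ) τ with Star-Stutter r ρ σ (Stutter-++ τ (once []))
... | _ , r′ , υ = _ , pop ◅ r′ , υ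
Star-Stutter {o′ = o′} (pop ◅ r) ρ (twice {p = p} σ) τ with Star-Stutter r ρ σ (Stutter-++ τ (twice []))
... | _ , r′ , υ = _ , pop ◅ pop ◅ subst (λ t → Star _⟶_ ⟨ _ , _ , t ⟩ _) (sym (++-assoc o′ [ p ] [ p ])) r′ , υ

-- The two neighboring copies of a letter cannot both serve a word whose adjacent letters differ.
Stutter-⊆ : Stutter l l′ → Linked _≢_ i → i ⊆ l′ → i ⊆ l
Stutter-⊆ [] _ s = s
Stutter-⊆ (once σ) lk (_ ∷ʳ s) = _ ∷ʳ Stutter-⊆ σ lk s
Stutter-⊆ (once σ) [-] (refl ∷ s) = refl ∷ minimum _
Stutter-⊆ (once σ) (_ ∷ lk) (refl ∷ s) = refl ∷ Stutter-⊆ σ lk s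
Stutter-⊆ (twice σ) lk (_ ∷ʳ _ ∷ʳ s) = _ ∷ʳ Stutter-⊆ σ lk s
Stutter-⊆ (twice σ) [-] (refl ∷ s) = refl ∷ minimum _
Stutter-⊆ (twice σ) [-] (_ ∷ʳ refl ∷ s) = refl ∷ minimum _
Stutter-⊆ (twice σ) (_ ∷ lk) (_ ∷ʳ refl ∷ s) = refl ∷ Stutter-⊆ σ lk s
Stutter-⊆ (twice σ) (_ ∷ lk) (refl ∷ _ ∷ʳ s) = refl ∷ Stutter-⊆ σ lk s
Stutter-⊆ (twice σ) (p≢p ∷ _) (refl ∷ refl ∷ s) = ⊥-elim (p≢p refl)

module _ {C : Set ℓ} (_≟_ : DecidableEquality C) where

  -- A sandwich of two colors has distinct neighbors, so by `Stutter-⊆` it would already occur in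
  -- the output without the doubling.
  FootSortable-double : ∀ {u v : List C} {p} → FootSortable (u ++ p ∷ v) → FootSortable (u ++ p ∷ p ∷ v)
  FootSortable-double {u} {v} (l , r , g) with Star-Stutter r (Stutter-++ (Stutter-refl u) (twice (Stutter-refl v))) [] []
  ... | l′ , r′ , υ = l′ , r′ , SandwichFree⇒Grouped _≟_ l′ sf
    where
    sf : SandwichFree l′
    sf {p} {q} s with p ≟ q
    ... | yes p≡q = p≡q
    ... | no p≢q = Grouped⇒SandwichFree g (Stutter-⊆ υ (p≢q ∷ (λ eq → p≢q (sym eq)) ∷ [-]) s)

-- Renaming colors

InjectiveOn : {B : Set ℓ} {C : Set ℓ′} → (B → C) → List B → Set _
InjectiveOn h l = ∀ {p q} → p ∈ l → q ∈ l → h p ≡ h q → p ≡ q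

Grouped-map⁺ : (h : B → C) → InjectiveOn h l → Grouped _≡_ l → Grouped _≡_ (map h l)
Grouped-map⁺ h inj [] = []
Grouped-map⁺ h inj (≉l ∷≉ g) =
  All.map⁺ (All.tabulate λ q∈l eq → All.lookup ≉l q∈l (inj (here refl) (there q∈l) eq))
  ∷≉ Grouped-map⁺ h (λ s t → inj (there s) (there t)) g
Grouped-map⁺ h inj (refl ∷≈ g) = refl ∷≈ Grouped-map⁺ h (λ s t → inj (there s) (there t)) g

Grouped-map⁻ : (h : B → C) (l : List B) → InjectiveOn h l → Grouped _≡_ (map h l) → Grouped _≡_ l
Grouped-map⁻ h [] inj g = []
Grouped-map⁻ h (p ∷ []) inj g = [] ∷≉ []
Grouped-map⁻ h (p ∷ q ∷ l) inj (≉l ∷≉ g) =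
  All.map (λ ne eq → ne (cong h eq)) (All.map⁻ ≉l) ∷≉ Grouped-map⁻ h (q ∷ l) (λ s t → inj (there s) (there t)) g
Grouped-map⁻ h (p ∷ q ∷ l) inj (eq ∷≈ g) =
  inj (here refl) (there (here refl)) eq ∷≈ Grouped-map⁻ h (q ∷ l) (λ s t → inj (there s) (there t)) g

Star-∈ : Star _⟶_ ⟨ i , st , o ⟩ ⟨ [] , [] , l ⟩ → ∀ {p} → p ∈ l → p ∈ i ⊎ p ∈ st ⊎ p ∈ o
Star-∈ ε p∈l = inj₂ (inj₂ p∈l)
Star-∈ (push ◅ r) p∈l with Star-∈ r p∈l
... | inj₁ p∈i = inj₁ (there p∈i)
... | inj₂ (inj₁ (here eq)) = inj₁ (here eq)
... | inj₂ (inj₁ (there p∈st)) = inj₂ (inj₁ p∈st)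
... | inj₂ (inj₂ p∈o) = inj₂ (inj₂ p∈o)
Star-∈ {o = o} (pop ◅ r) p∈l with Star-∈ r p∈l
... | inj₁ p∈i = inj₁ p∈i
... | inj₂ (inj₁ p∈st) = inj₂ (inj₁ (there p∈st))
... | inj₂ (inj₂ p∈o) with ∈-++⁻ o p∈o
... | inj₁ p∈o = inj₂ (inj₂ p∈o)
... | inj₂ (here eq) = inj₂ (inj₁ (here eq))

Star-map⁺ : (h : B → C) → Star _⟶_ ⟨ i , st , o ⟩ ⟨ [] , [] , l ⟩ →
  Star _⟶_ ⟨ map h i , map h st , map h o ⟩ ⟨ [] , [] , map h l ⟩
Star-map⁺ h ε = ε
Star-map⁺ h (push ◅ r) = push ◅ Star-map⁺ h r
Star-map⁺ {o = o} h (pop ◅ r) =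
  pop ◅ subst (λ t → Star _⟶_ ⟨ _ , _ , t ⟩ _) (map-++ h o _) (Star-map⁺ h r)

-- Moves depend on positions and not on colors, so runs lift along any map; injectivity enters only
-- through groupedness.
Star-map⁻ : (h : B → C) (i st o : List B) {l : List C} → Star _⟶_ ⟨ map h i , map h st , map h o ⟩ ⟨ [] , [] , l ⟩ →
  ∃[ l′ ] Star _⟶_ ⟨ i , st , o ⟩ ⟨ [] , [] , l′ ⟩ × map h l′ ≡ l
Star-map⁻ h [] [] o ε = o , ε , refl
Star-map⁻ h (p ∷ i) [] o (push ◅ r) with Star-map⁻ h i (p ∷ []) o r
... | l′ , r′ , eq = l′ , push ◅ r′ , eq
Star-map⁻ h (p ∷ i) (q ∷ st) o (push ◅ r) with Star-map⁻ h i (p ∷ q ∷ st) o r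
... | l′ , r′ , eq = l′ , push ◅ r′ , eq
Star-map⁻ h [] (p ∷ st) o (pop ◅ r)
  with Star-map⁻ h [] st (o ++ [ p ]) (subst (λ t → Star _⟶_ ⟨ _ , _ , t ⟩ _) (sym (map-++ h o [ p ])) r)
... | l′ , r′ , eq = l′ , pop ◅ r′ , eq
Star-map⁻ h (q ∷ i) (p ∷ st) o (pop ◅ r)
  with Star-map⁻ h (q ∷ i) st (o ++ [ p ]) (subst (λ t → Star _⟶_ ⟨ _ , _ , t ⟩ _) (sym (map-++ h o [ p ])) r)
... | l′ , r′ , eq = l′ , pop ◅ r′ , eq

FootSortable-map⁺ : (h : B → C) → InjectiveOn h i → FootSortable i → FootSortable (map h i)
FootSortable-map⁺ {i = i} h inj (l , r , g) = map h l , Star-map⁺ h r , Grouped-map⁺ h (λ s t → inj (∈i s) (∈i t)) g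
  where
  ∈i : ∀ {p} → p ∈ l → p ∈ i
  ∈i p∈l with Star-∈ r p∈l
  ... | inj₁ p∈i = p∈i
  ... | inj₂ (inj₁ ())
  ... | inj₂ (inj₂ ())

FootSortable-map⁻ : (h : B → C) (i : List B) → InjectiveOn h i → FootSortable (map h i) → FootSortable i
FootSortable-map⁻ h i inj (l , r , g) with Star-map⁻ h i [] [] r
... | l′ , r′ , refl = l′ , r′ , Grouped-map⁻ h l′ (λ s t → inj (∈i s) (∈i t)) g
  where
  ∈i : ∀ {p} → p ∈ l′ → p ∈ i
  ∈i p∈l with Star-∈ r′ p∈l
  ... | inj₁ p∈i = p∈i
  ... | inj₂ (inj₁ ())
  ... | inj₂ (inj₂ ())

-- Runs and their outputs

Star-output : Star _⟶_ ⟨ i , st , o ⟩ ⟨ [] , [] , l ⟩ → o ++ st ⊆ l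
Star-output {o = o} ε = ⊆-reflexive (++-identityʳ o)
Star-output {o = o} (push ◅ r) = ⊆-trans (++⁺ (⊆-refl {x = o}) (_ ∷ʳ ⊆-refl)) (Star-output r)
Star-output {o = o} (pop {st = st} ◅ r) = subst (_⊆ _) (++-assoc o _ st) (Star-output r)

Star-input : Star _⟶_ ⟨ i , st , o ⟩ ⟨ [] , [] , l ⟩ → ∀ {p} → p ∈ i → o ++ [ p ] ⊆ l
Star-input {o = o} (push ◅ r) (here refl) = ⊆-trans (++⁺ (⊆-refl {x = o}) (refl ∷ minimum _)) (Star-output r)
Star-input (push ◅ r) (there p∈i) = Star-input r p∈i
Star-input {o = o} (pop {s = s} ◅ r) p∈i = ⊆-trans (++⁺ (++⁺ʳ [ s ] (⊆-refl {x = o})) ⊆-refl) (Star-input r p∈i)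

-- Runs in which a color is output in one go: either both socks sit together on
-- top of the stack, or the first one is output and nothing else leaves the
-- stack until the second one arrives.
data Sorts {C : Set ℓ} : List C → List C → Set ℓ where
  done : Sorts [] []
  put  : Sorts i (p ∷ st) → Sorts (p ∷ i) st
  pop₁ : p ∉ i → p ∉ st → Sorts i st → Sorts i (p ∷ st)
  pop₂ : p ∉ i → p ∉ st → Sorts i st → Sorts i (p ∷ p ∷ st)
  lock : p ∉ i → p ∉ us → p ∉ st → Sorts i (us ʳ++ st) → Sorts (us ++ p ∷ i) (p ∷ st)

∈-ʳ++⁻ : ∀ us → p ∈ us ʳ++ st → p ∈ us ⊎ p ∈ st
∈-ʳ++⁻ [] p∈ = inj₂ p∈
∈-ʳ++⁻ (q ∷ us) p∈ with ∈-ʳ++⁻ us p∈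
... | inj₁ p∈us = inj₁ (there p∈us)
... | inj₂ (here eq) = inj₁ (here eq)
... | inj₂ (there p∈st) = inj₂ p∈st

Grouped-snoc : Grouped _≡_ o → p ∉ o → Grouped _≡_ (o ++ [ p ])
Grouped-snoc [] p∉o = [] ∷≉ []
Grouped-snoc (≉o ∷≉ g) p∉o = All.++⁺ ≉o ((λ eq → p∉o (here (sym eq))) ∷ []) ∷≉ Grouped-snoc g (p∉o ∘ there)
Grouped-snoc (eq ∷≈ g) p∉o = eq ∷≈ Grouped-snoc g (p∉o ∘ there)

Grouped-snoc² : Grouped _≡_ o → p ∉ o → Grouped _≡_ ((o ++ [ p ]) ++ [ p ])
Grouped-snoc² [] p∉o = refl ∷≈ [] ∷≉ []
Grouped-snoc² (≉o ∷≉ g) p∉o =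
  All.++⁺ (All.++⁺ ≉o (p≢ ∷ [])) (p≢ ∷ []) ∷≉ Grouped-snoc² g (p∉o ∘ there)
  where p≢ = λ eq → p∉o (here (sym eq))
Grouped-snoc² (eq ∷≈ g) p∉o = eq ∷≈ Grouped-snoc² g (p∉o ∘ there)

Star-pushes : ∀ us → Star _⟶_ ⟨ us ++ i , st , o ⟩ ⟨ i , us ʳ++ st , o ⟩
Star-pushes [] = ε
Star-pushes (p ∷ us) = push ◅ Star-pushes us

-- The invariant under which a color appended to the output opens a new block: the colors already
-- output are complete.
Disjoint : {C : Set ℓ} → List C → List C → List C → Set ℓ
Disjoint o i st = ∀ {p} → p ∈ o → p ∉ i × p ∉ st

Disjoint-snoc : Disjoint o i st → p ∉ i → p ∉ st → Disjoint (o ++ [ p ]) i st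
Disjoint-snoc {o = o} disj ∉i ∉st q∈ with ∈-++⁻ o q∈
... | inj₁ q∈o = disj q∈o
... | inj₂ (here refl) = ∉i , ∉st

Sorts⇒Star : Sorts i st → Grouped _≡_ o → Disjoint o i st →
  ∃[ l ] Star _⟶_ ⟨ i , st , o ⟩ ⟨ [] , [] , l ⟩ × Grouped _≡_ l
Sorts⇒Star done g disj = _ , ε , g
Sorts⇒Star {o = o} (put {i = i} {p = p} {st = st} s) g disj =
  let l , r , g′ = Sorts⇒Star s g disj′ in l , push ◅ r , g′
  where
  disj′ : Disjoint o i (p ∷ st)
  disj′ q∈o = proj₁ (disj q∈o) ∘ there ,
    λ { (here eq) → proj₁ (disj q∈o) (here eq) ; (there q∈st) → proj₂ (disj q∈o) q∈st }
Sorts⇒Star (pop₁ ∉i ∉st s) g disj =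
  let l , r , g′ = Sorts⇒Star s (Grouped-snoc g λ p∈o → proj₂ (disj p∈o) (here refl))
                     (Disjoint-snoc (λ q∈o → proj₁ (disj q∈o) , proj₂ (disj q∈o) ∘ there) ∉i ∉st)
  in l , pop ◅ r , g′
Sorts⇒Star (pop₂ ∉i ∉st s) g disj =
  let l , r , g′ = Sorts⇒Star s (Grouped-snoc² g λ p∈o → proj₂ (disj p∈o) (here refl))
                     (Disjoint-snoc (Disjoint-snoc
                       (λ q∈o → proj₁ (disj q∈o) , proj₂ (disj q∈o) ∘ there ∘ there) ∉i ∉st) ∉i ∉st)
  in l , pop ◅ pop ◅ r , g′
Sorts⇒Star {o = o} (lock {p = p} {i = i} {us = us} {st = st} ∉i ∉us ∉st s) g disj =
  let l , r , g′ = Sorts⇒Star s (Grouped-snoc² g λ p∈o → proj₂ (disj p∈o) (here refl))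
                     (Disjoint-snoc (Disjoint-snoc disj′ ∉i ∉st′) ∉i ∉st′)
  in l , pop ◅ (Star-pushes us ◅◅ push ◅ pop ◅ r) , g′
  where
  ∉st′ : p ∉ us ʳ++ st
  ∉st′ p∈ with ∈-ʳ++⁻ us p∈
  ... | inj₁ p∈us = ∉us p∈us
  ... | inj₂ p∈st = ∉st p∈st
  disj′ : Disjoint o i (us ʳ++ st)
  disj′ q∈o = (λ q∈i → proj₁ (disj q∈o) (∈-++⁺ʳ us (there q∈i))) , λ q∈ → old (∈-ʳ++⁻ us q∈)
    where
    old : _ ∈ us ⊎ _ ∈ st → ⊥
    old (inj₁ q∈us) = proj₁ (disj q∈o) (∈-++⁺ˡ q∈us)
    old (inj₂ q∈st) = proj₂ (disj q∈o) (there q∈st)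

Sorts⇒FootSortable : Sorts i [] → FootSortable i
Sorts⇒FootSortable s = Sorts⇒Star s [] λ ()

-- Listed words as subsequences

NoTriple : {C : Set ℓ} → List C → Set ℓ
NoTriple s = ∀ {p} → ¬ (p ∷ p ∷ p ∷ [] ⊆ s)

-- An embedding of l cuts w into gaps, and an occurrence of q is either matched already or falls
-- into a gap. The case distinctions by the place of a first sock come from here.
insert : {l w : List C} {q : C} → l ⊆ w → q ∈ w →
  q ∈ l ⊎ ∃[ l₁ ] ∃[ l₂ ] l ≡ l₁ ++ l₂ × l₁ ++ q ∷ l₂ ⊆ w
insert (refl ∷ τ) (here eq) = inj₁ (here eq)
insert {l = l} (_ ∷ʳ τ) (here refl) = inj₂ ([] , l , refl , refl ∷ τ)
insert (refl ∷ τ) (there q∈w) with insert τ q∈w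
... | inj₁ q∈l = inj₁ (there q∈l)
... | inj₂ (l₁ , l₂ , refl , υ) = inj₂ (_ ∷ l₁ , l₂ , refl , refl ∷ υ)
insert (_ ∷ʳ τ) (there q∈w) with insert τ q∈w
... | inj₁ q∈l = inj₁ q∈l
... | inj₂ (l₁ , l₂ , eq , υ) = inj₂ (l₁ , l₂ , eq , _ ∷ʳ υ)

-- At most one color of such a word occurs only once. Identifying two colors then produces a triple.
Tight : {B : Set ℓ} → List B → Set ℓ
Tight w = ∀ {p q} → p ∈ w → q ∈ w → p ≡ q ⊎ p ∷ p ∷ [] ⊆ w ⊎ q ∷ q ∷ [] ⊆ w

-- Two colors of a tight word that are identified occur at least three times in total.
double-inj : (h : B → C) {w : List B} → NoTriple (map h w) → ∀ {p q} → p ∷ p ∷ [] ⊆ w → q ∈ w → h p ≡ h q → p ≡ q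
double-inj h {w} nt {p} pp q∈w eq with insert pp q∈w
... | inj₁ (here refl) = refl
... | inj₁ (there (here refl)) = refl
... | inj₂ ([] , _ , refl , υ) = ⊥-elim (nt (subst (λ t → t ∷ h p ∷ h p ∷ [] ⊆ map h w) (sym eq) (Sub.map⁺ h υ)))
... | inj₂ (_ ∷ [] , _ , refl , υ) = ⊥-elim (nt (subst (λ t → h p ∷ t ∷ h p ∷ [] ⊆ map h w) (sym eq) (Sub.map⁺ h υ)))
... | inj₂ (_ ∷ _ ∷ [] , [] , refl , υ) = ⊥-elim (nt (subst (λ t → h p ∷ h p ∷ t ∷ [] ⊆ map h w) (sym eq) (Sub.map⁺ h υ)))

Tight⇒InjectiveOn : (h : B → C) {w : List B} → Tight w → NoTriple (map h w) → InjectiveOn h w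
Tight⇒InjectiveOn h tight nt p∈w q∈w eq with tight p∈w q∈w
... | inj₁ p≡q = p≡q
... | inj₂ (inj₁ pp) = double-inj h nt pp q∈w eq
... | inj₂ (inj₂ qq) = sym (double-inj h nt qq p∈w (sym eq))

Listed : {C : Set ℓ} → List C → Set ℓ
Listed s =
    Any (λ w → w RenamesTo s) sporadic
  ⊎ (∃[ n ] n ≥ 2 × familyA n RenamesTo s)
  ⊎ (∃[ n ] n ≥ 3 × familyB n RenamesTo s)
  ⊎ (∃[ n ] n ≥ 3 × familyB′ n RenamesTo s)
  ⊎ (∃[ n ] n ≥ 3 × familyC n RenamesTo s)

Contains : {C : Set ℓ} → List C → Set ℓ
Contains s = ∃[ w ] w ⊆ s × Listed w

NoTriple-⊆ : {w s : List C} → w ⊆ s → NoTriple s → NoTriple w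
NoTriple-⊆ τ nt υ = nt (⊆-trans υ τ)

-- Sporadic words

code : SporadicColor → ℕ
code a = 0
code b = 1
code c = 2
code d = 3
code e = 4
code f = 5

-- A substitution given by the images of `a` to `f`; letters that a word lacks get a filler.
palette : C → C → C → C → C → C → SporadicColor → C
palette p q r t u v a = p
palette p q r t u v b = q
palette p q r t u v c = r
palette p q r t u v d = t
palette p q r t u v e = u
palette p q r t u v f = v

decode : ℕ → SporadicColor
decode 0 = a
decode 1 = b
decode 2 = c
decode 3 = d
decode 4 = e
decode _ = f

decode-code : ∀ p → decode (code p) ≡ p
decode-code a = refl
decode-code b = refl
decode-code c = refl
decode-code d = refl
decode-code e = refl
decode-code f = refl

_≟ₛ_ : DecidableEquality SporadicColor
p ≟ₛ q = map′ (λ eq → trans (sym (decode-code p)) (trans (cong decode eq) (decode-code q))) (cong code) (code p ℕ.≟ code q)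

open import Data.List.Relation.Binary.Sublist.DecPropositional _≟ₛ_ using (_⊆?_)

Tight? : (w : List SporadicColor) → Dec (All (λ p → All (λ q → p ≡ q ⊎ p ∷ p ∷ [] ⊆ w ⊎ q ∷ q ∷ [] ⊆ w) w) w)
Tight? w = All.all? (λ p → All.all? (λ q → (p ≟ₛ q) ⊎-dec ((p ∷ p ∷ [] ⊆? w) ⊎-dec (q ∷ q ∷ [] ⊆? w))) w) w

Any-at : ∀ {A : Set} {P : A → Set ℓ} {n} (xs : Vec A n) (j : Fin n) → P (lookup xs j) → Any P xs
Any-at (_ ∷ _) zero pj = VecAny.here pj
Any-at (_ ∷ xs) (suc j) pj = VecAny.there (Any-at xs j pj)

contains-sporadic : {s : List C} → NoTriple s → (j : Fin 14) {_ : True (Tight? (lookup sporadic j))}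
  (h : SporadicColor → C) → map h (lookup sporadic j) ⊆ s → Contains s
contains-sporadic nt j {tight} h τ =
  _ , τ , inj₁ (Any-at sporadic j (h , Tight⇒InjectiveOn h
    (λ p∈ q∈ → All.lookup (All.lookup (toWitness tight) p∈) q∈) (NoTriple-⊆ τ nt) , refl))

-- `W` spells the pattern found in `s`, and `ρ` translates the listed word into its letters, so that
-- the match is checked by evaluation.
contains-word : {s : List C} → NoTriple s → (W : List SporadicColor) (j : Fin 14) {_ : True (Tight? (lookup sporadic j))}
  (ρ : SporadicColor → SporadicColor) {_ : True (map ρ (lookup sporadic j) ⊆? W)}
  (h : SporadicColor → C) → map h W ⊆ s → Contains s
contains-word nt W j {tight} ρ {emb} h τ =
  contains-sporadic nt j {tight} (h ∘ ρ)
    (subst (_⊆ _) (sym (map-∘ (lookup sporadic j))) (⊆-trans (Sub.map⁺ h (toWitness emb)) τ))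

-- The last sporadic word has two colors that occur only once.
contains-last : {s : List C} → NoTriple s → (h : SporadicColor → C) → h d ≢ h f →
  map h (a ∷ b ∷ c ∷ d ∷ c ∷ a ∷ e ∷ f ∷ e ∷ b ∷ []) ⊆ s → Contains s
contains-last {s = s} nt h d≢f τ =
  _ , τ , inj₁ (Any-at sporadic (Fin.fromℕ 13) (h , inj , refl))
  where
  w = a ∷ b ∷ c ∷ d ∷ c ∷ a ∷ e ∷ f ∷ e ∷ b ∷ []
  tight : ∀ p q → p ≡ q ⊎ (p ∷ p ∷ [] ⊆ w ⊎ q ∷ q ∷ [] ⊆ w) ⊎ (p ≡ d × q ≡ f ⊎ p ≡ f × q ≡ d)
  tight a q = inj₂ (inj₁ (inj₁ (toWitness {a? = a ∷ a ∷ [] ⊆? w} _)))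
  tight b q = inj₂ (inj₁ (inj₁ (toWitness {a? = b ∷ b ∷ [] ⊆? w} _)))
  tight c q = inj₂ (inj₁ (inj₁ (toWitness {a? = c ∷ c ∷ [] ⊆? w} _)))
  tight e q = inj₂ (inj₁ (inj₁ (toWitness {a? = e ∷ e ∷ [] ⊆? w} _)))
  tight p a = inj₂ (inj₁ (inj₂ (toWitness {a? = a ∷ a ∷ [] ⊆? w} _)))
  tight p b = inj₂ (inj₁ (inj₂ (toWitness {a? = b ∷ b ∷ [] ⊆? w} _)))
  tight p c = inj₂ (inj₁ (inj₂ (toWitness {a? = c ∷ c ∷ [] ⊆? w} _)))
  tight p e = inj₂ (inj₁ (inj₂ (toWitness {a? = e ∷ e ∷ [] ⊆? w} _)))
  tight d d = inj₁ refl
  tight d f = inj₂ (inj₂ (inj₁ (refl , refl)))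
  tight f d = inj₂ (inj₂ (inj₂ (refl , refl)))
  tight f f = inj₁ refl
  inj : InjectiveOn h w
  inj {p} {q} p∈w q∈w eq with tight p q
  ... | inj₁ p≡q = p≡q
  ... | inj₂ (inj₁ (inj₁ pp)) = double-inj h (NoTriple-⊆ τ nt) pp q∈w eq
  ... | inj₂ (inj₁ (inj₂ qq)) = sym (double-inj h (NoTriple-⊆ τ nt) qq p∈w (sym eq))
  ... | inj₂ (inj₂ (inj₁ (refl , refl))) = ⊥-elim (d≢f eq)
  ... | inj₂ (inj₂ (inj₂ (refl , refl))) = ⊥-elim (d≢f (sym eq))

-- Families

data Family : Set where
  fA fB fB′ fC : Family

-- The family word up to its descent, with u for α₀ and v for αₙ₋₁. Keeping the colors as parameters
-- lets it be located in a word before the descent is known.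
start : Family → C → C → C → C → C → List C
start fA p q r u v = p ∷ u ∷ q ∷ v ∷ p ∷ []
start fB p q r u v = u ∷ p ∷ q ∷ v ∷ p ∷ q ∷ []
start fB′ p q r u v = u ∷ q ∷ p ∷ v ∷ p ∷ q ∷ []
start fC p q r u v = u ∷ p ∷ v ∷ q ∷ r ∷ q ∷ p ∷ []

-- With n = k + 2, this is the least admissible k.
least : Family → ℕ
least fA = 0
least fB = 1
least fB′ = 1
least fC = 1

family : Family → ℕ → List FamilyColor
family F n = start F x y z (α 0) (α (n ∸ 1)) ++ descent n

run : (ℕ → C) → ℕ → List C
run g zero = []
run g (suc zero) = []
run g (suc (suc k)) = g k ∷ g (suc k) ∷ run g (suc k)

-- The smallest indices stand at the end of the descent. Reading further therefore puts a new color
-- in front of the sequence `g` and shifts all other indices.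
run-snoc : (g : ℕ → C) → ∀ k → run g (suc (suc k)) ≡ run (g ∘ suc) (suc k) ++ g 0 ∷ g 1 ∷ []
run-snoc g zero = refl
run-snoc g (suc k) = cong (λ l → g (suc k) ∷ g (suc (suc k)) ∷ l) (run-snoc g k)

colors : C → C → C → (ℕ → C) → FamilyColor → C
colors p q r g x = p
colors p q r g y = q
colors p q r g z = r
colors p q r g (α j) = g j

map-descent : (p q r : C) (g : ℕ → C) → ∀ n → map (colors p q r g) (descent n) ≡ run g n
map-descent p q r g zero = refl
map-descent p q r g (suc zero) = refl
map-descent p q r g (suc (suc k)) = cong (λ l → g k ∷ g (suc k) ∷ l) (map-descent p q r g (suc k))

map-family : ∀ F (p q r : C) (g : ℕ → C) n →
  map (colors p q r g) (family F n) ≡ start F p q r (g 0) (g (n ∸ 1)) ++ run g n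
map-family fA p q r g n rewrite map-descent p q r g n = refl
map-family fB p q r g n rewrite map-descent p q r g n = refl
map-family fB′ p q r g n rewrite map-descent p q r g n = refl
map-family fC p q r g n rewrite map-descent p q r g n = refl

∈-descent : ∀ n {p} → p ∈ descent n → ∃[ j ] suc j ≤ n × p ≡ α j
∈-descent (suc (suc k)) (here refl) = k , n≤1+n _ , refl
∈-descent (suc (suc k)) (there (here refl)) = suc k , ≤-refl , refl
∈-descent (suc (suc k)) (there (there p∈)) with ∈-descent (suc k) p∈
... | j , j< , eq = j , ≤-trans j< (n≤1+n _) , eq

α∈descent : ∀ {j} k → j ≤ k → α j ∈ descent (suc (suc k))
α∈descent {j} k j≤k with ℕ.m≤n⇒m<n∨m≡n j≤k
α∈descent {j} (suc k) _ | inj₁ (s≤s j≤k) = there (there (α∈descent k j≤k))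
... | inj₂ refl = here refl

αα⊆descent : ∀ {j} k → suc j ≤ k → α (suc j) ∷ α (suc j) ∷ [] ⊆ descent (suc (suc k))
αα⊆descent (suc k) j<k with ℕ.m≤n⇒m<n∨m≡n j<k
... | inj₁ (s≤s j≤k) = _ ∷ʳ _ ∷ʳ αα⊆descent k j≤k
... | inj₂ refl = refl ∷ _ ∷ʳ _ ∷ʳ refl ∷ minimum _

-- The color that does not occur twice: y in A and z in C occur once, and z is absent from B and B′.
rare : Family → FamilyColor
rare fA = y
rare fB = z
rare fB′ = z
rare fC = z

-- α₀ and αₙ₋₁ occur once before the descent and once in it, and the other α twice in the descent.
double-family : ∀ F k {p} → p ∈ family F (suc (suc k)) → p ∷ p ∷ [] ⊆ family F (suc (suc k)) ⊎ p ≡ rare F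
double-family F k {α j} p∈ = inj₁ (αα j (bound F p∈))
  where
  bound : ∀ F → α j ∈ family F (suc (suc k)) → j ≤ suc k
  bound′ : α j ∈ descent (suc (suc k)) → j ≤ suc k
  bound′ p∈ with ∈-descent _ p∈
  ... | _ , s≤s j≤ , refl = j≤
  bound fA (there (here refl)) = z≤n
  bound fA (there (there (there (here refl)))) = ≤-refl
  bound fA (there (there (there (there (there p∈))))) = bound′ p∈
  bound fB (here refl) = z≤n
  bound fB (there (there (there (here refl)))) = ≤-refl
  bound fB (there (there (there (there (there (there p∈)))))) = bound′ p∈
  bound fB′ (here refl) = z≤n
  bound fB′ (there (there (there (here refl)))) = ≤-refl
  bound fB′ (there (there (there (there (there (there p∈)))))) = bound′ p∈
  bound fC (here refl) = z≤n
  bound fC (there (there (here refl))) = ≤-refl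
  bound fC (there (there (there (there (there (there (there p∈))))))) = bound′ p∈
  low : ∀ F → α 0 ∈ start F x y z (α 0) (α (suc k))
  low fA = there (here refl)
  low fB = here refl
  low fB′ = here refl
  low fC = here refl
  high : ∀ F → α (suc k) ∈ start F x y z (α 0) (α (suc k))
  high fA = there (there (there (here refl)))
  high fB = there (there (there (here refl)))
  high fB′ = there (there (there (here refl)))
  high fC = there (there (here refl))
  αα : ∀ j → j ≤ suc k → α j ∷ α j ∷ [] ⊆ family F (suc (suc k))
  αα zero _ = ++⁺ (from∈ (low F)) (from∈ (α∈descent k z≤n))
  αα (suc j) (s≤s j≤k) with ℕ.m≤n⇒m<n∨m≡n j≤k
  ... | inj₁ j<k = ++⁺ˡ (start F x y z (α 0) (α (suc k))) (αα⊆descent k j<k)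
  ... | inj₂ refl = ++⁺ (from∈ (high F)) (from∈ {bs = descent (suc (suc k))} (there (here refl)))
double-family F k {x} _ = inj₁ (++⁺ʳ (descent (suc (suc k))) (xx F))
  where
  xx : ∀ F → x ∷ x ∷ [] ⊆ start F x y z (α 0) (α (suc k))
  xx fA = refl ∷ _ ∷ʳ _ ∷ʳ _ ∷ʳ refl ∷ []
  xx fB = _ ∷ʳ refl ∷ _ ∷ʳ _ ∷ʳ refl ∷ _ ∷ʳ []
  xx fB′ = _ ∷ʳ _ ∷ʳ refl ∷ _ ∷ʳ refl ∷ _ ∷ʳ []
  xx fC = _ ∷ʳ refl ∷ _ ∷ʳ _ ∷ʳ _ ∷ʳ _ ∷ʳ refl ∷ []
double-family fA k {y} _ = inj₂ refl
double-family fB k {y} _ = inj₁ (_ ∷ʳ _ ∷ʳ refl ∷ _ ∷ʳ _ ∷ʳ refl ∷ minimum _)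
double-family fB′ k {y} _ = inj₁ (_ ∷ʳ refl ∷ _ ∷ʳ _ ∷ʳ _ ∷ʳ refl ∷ minimum _)
double-family fC k {y} _ = inj₁ (_ ∷ʳ _ ∷ʳ _ ∷ʳ refl ∷ _ ∷ʳ refl ∷ minimum _)
double-family fA k {z} (there (there (there (there (there p∈))))) with ∈-descent (suc (suc k)) p∈
... | _ , _ , ()
double-family fB k {z} _ = inj₂ refl
double-family fB′ k {z} _ = inj₂ refl
double-family fC k {z} _ = inj₂ refl

Tight-family : ∀ F k → Tight (family F (suc (suc k)))
Tight-family F k p∈ q∈ with double-family F k p∈ | double-family F k q∈
... | inj₁ pp | _ = inj₂ (inj₁ pp)
... | inj₂ _ | inj₁ qq = inj₂ (inj₂ qq)
... | inj₂ refl | inj₂ refl = inj₁ refl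

Listed-family : ∀ F k → least F ≤ k → {s : List C} → family F (suc (suc k)) RenamesTo s → Listed s
Listed-family fA k k≥ ren = inj₂ (inj₁ (_ , s≤s (s≤s k≥) , ren))
Listed-family fB k k≥ ren = inj₂ (inj₂ (inj₁ (_ , s≤s (s≤s k≥) , ren)))
Listed-family fB′ k k≥ ren = inj₂ (inj₂ (inj₂ (inj₁ (_ , s≤s (s≤s k≥) , ren))))
Listed-family fC k k≥ ren = inj₂ (inj₂ (inj₂ (inj₂ (_ , s≤s (s≤s k≥) , ren))))

contains-family : {s : List C} → NoTriple s → ∀ F k → least F ≤ k → (p q r : C) (g : ℕ → C) →
  start F p q r (g 0) (g (suc k)) ++ run g (suc (suc k)) ⊆ s → Contains s
contains-family nt F k k≥ p q r g τ = _ , τ′ ,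
    Listed-family F k k≥ (h , Tight⇒InjectiveOn h (Tight-family F k) (NoTriple-⊆ τ′ nt) , refl)
  where
  h = colors p q r g
  τ′ = subst (_⊆ _) (sym (map-family F p q r g (suc (suc k)))) τ

-- The greedy strategy

cons : C → (ℕ → C) → ℕ → C
cons p g zero = p
cons p g (suc n) = g n

-- The word P contains a family word with α₀ = p and α₁ = q, except for the
-- last two letters.
record Bullet {C : Set ℓ} (P : List C) (p q : C) : Set ℓ where
  constructor bullet
  field
    F : Family
    k : ℕ
    k≥ : least F ≤ k
    u v w : C
    g : ℕ → C
    g₀ : g 0 ≡ q
    sub : start F u v w p (g k) ++ run g (suc k) ⊆ P

Bullet-mono : {P P′ : List C} {p q : C} → P ⊆ P′ → Bullet P p q → Bullet P′ p q
Bullet-mono τ (bullet F k k≥ u v w g g₀ sub) = bullet F k k≥ u v w g g₀ (⊆-trans sub τ)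

run-extend : {P P′ : List C} {q r : C} (l : List C) (g : ℕ → C) (k : ℕ) → g 0 ≡ q → l ++ run g (suc k) ⊆ P →
  P ++ r ∷ q ∷ [] ⊆ P′ → l ++ run (cons r g) (suc (suc k)) ⊆ P′
run-extend {r = r} l g k refl τ υ = ⊆-trans (⊆-reflexive eq) (⊆-trans (++⁺ τ ⊆-refl) υ)
  where
  eq : l ++ run (cons r g) (suc (suc k)) ≡ (l ++ run g (suc k)) ++ r ∷ g 0 ∷ []
  eq = trans (cong (l ++_) (run-snoc (cons r g) k)) (sym (++-assoc l (run g (suc k)) (r ∷ g 0 ∷ [])))

-- The letters r and q play α₁α₂: r becomes the new α₁, and q, the old α₁, becomes α₂. As `g` starts
-- at α₁, the word has n = k + 2, and αₙ₋₁ is `g k`.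
Bullet-extend : {P P′ : List C} {p q r : C} → Bullet P p q → P ++ r ∷ q ∷ [] ⊆ P′ → Bullet P′ p r
Bullet-extend {p = p} (bullet F k k≥ u v w g g₀ sub) τ =
  bullet F (suc k) (≤-trans k≥ (n≤1+n k)) u v w (cons _ g) refl
    (run-extend (start F u v w p (g k)) g k g₀ sub τ)

-- The letters p and q play α₀α₁, the end of the descent.
Bullet-close : {s P : List C} {p q : C} → NoTriple s → Bullet P p q → P ++ p ∷ q ∷ [] ⊆ s → Contains s
Bullet-close {p = p} nt (bullet F k k≥ u v w g g₀ sub) τ =
  contains-family nt F k k≥ u v w (cons p g) (run-extend (start F u v w p (g k)) g k g₀ sub τ)

-- This is xα₀yα₁xα₀α₁, family A for n = 2, the only family word that arises without a bullet.
contains-A : {s : List C} → NoTriple s → ∀ {p q u v} → p ∷ u ∷ q ∷ v ∷ p ∷ u ∷ v ∷ [] ⊆ s → Contains s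
contains-A nt {p} {q} {u} {v} τ = contains-family nt fA 0 z≤n p q p (cons u (λ _ → v)) τ

-- Such a `ws` is a stretch of input in which no second sock arrives.
data New {C : Set ℓ} : List C → List C → Set ℓ where
  []  : ∀ {P} → New P []
  _∷_ : ∀ {P p ws} → p ∉ P → New (P ++ [ p ]) ws → New P (p ∷ ws)

New-∉ : ∀ {P ws : List C} {p} → New P ws → p ∈ ws → p ∉ P
New-∉ (p∉P ∷ new) (here refl) p∈P = p∉P p∈P
New-∉ (_ ∷ new) (there p∈ws) p∈P = New-∉ new p∈ws (∈-++⁺ˡ p∈P)

New-head : ∀ {P ws : List C} {p} → New P (p ∷ ws) → p ∉ ws
New-head {P = P} (_ ∷ new) p∈ws = New-∉ new p∈ws (∈-++⁺ʳ P (here refl))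

-- The flag tells whether a bullet lies on top of the stack. Whenever a color opens on a bullet that
-- has an open color below it, the origin of the bullet is recorded as a `Bullet`.
data Stack {C : Set ℓ} (P R : List C) : Bool → List C → List C → Set ℓ where
  []    : Stack P R false [] []
  open₁ : ∀ {t os st p} → p ∉ st → (t ≡ true → ∀ {q os′} → os ≡ q ∷ os′ → Bullet P q p) →
          Stack P R t os st → Stack P R false (p ∷ os) (p ∷ st)
  shut₁ : ∀ {t os st p} → p ∉ R → p ∉ st → Stack P R t os st → Stack P R true os (p ∷ st)
  shut₂ : ∀ {t os st p} → p ∉ R → p ∉ st → Stack P R t os st → Stack P R true os (p ∷ p ∷ st)

Stack-mono : ∀ {P P′ R R′ : List C} {t os st} → P ⊆ P′ → (∀ {p} → p ∈ R′ → p ∈ R) → Stack P R t os st → Stack P′ R′ t os st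
Stack-mono τ ρ [] = []
Stack-mono τ ρ (open₁ p∉ bul stk) = open₁ p∉ (λ t≡ os≡ → Bullet-mono τ (bul t≡ os≡)) (Stack-mono τ ρ stk)
Stack-mono τ ρ (shut₁ p∉R p∉ stk) = shut₁ (p∉R ∘ ρ) p∉ (Stack-mono τ ρ stk)
Stack-mono τ ρ (shut₂ p∉R p∉ stk) = shut₂ (p∉R ∘ ρ) p∉ (Stack-mono τ ρ stk)

record Opens {C : Set ℓ} (P R os : List C) : Set ℓ where
  constructor opens
  field
    ordered  : reverse os ⊆ P
    pending  : ∀ {p} → p ∈ os → p ∈ R
    complete : ∀ {p} → p ∈ P → p ∈ R → p ∈ os

∈-reverse : ∀ {l : List C} {p} → p ∈ l → p ∈ reverse l
∈-reverse p∈ = to∈ (reverse⁺ (from∈ p∈))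

module _ {P : List C} where

  Opens-∈ : ∀ {R os p} → Opens P R os → p ∈ os → p ∈ P
  Opens-∈ op p∈ = Any-resp-⊆ (Opens.ordered op) (∈-reverse p∈)

  Opens-single : ∀ {R os p} → p ∉ P → p ∉ R → Opens P (p ∷ R) os → Opens (P ++ [ p ]) R os
  Opens-single {R} {os} {p} p∉P p∉R op@(opens ord pend comp) = opens (++⁺ʳ _ ord) pend′ comp′
    where
    pend′ : ∀ {q} → q ∈ os → q ∈ R
    pend′ q∈ with pend q∈
    ... | here refl = ⊥-elim (p∉P (Opens-∈ op q∈))
    ... | there q∈R = q∈R
    comp′ : ∀ {q} → q ∈ P ++ [ p ] → q ∈ R → q ∈ os
    comp′ q∈ q∈R with ∈-++⁻ P q∈
    ... | inj₁ q∈P = comp q∈P (there q∈R)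
    ... | inj₂ (here refl) = ⊥-elim (p∉R q∈R)

  Opens-first : ∀ {R os p} → p ∉ P → p ∈ R → Opens P (p ∷ R) os → Opens (P ++ [ p ]) R (p ∷ os)
  Opens-first {R} {os} {p} p∉P p∈R op@(opens ord pend comp) =
    opens (subst (_⊆ _) (sym (unfold-reverse p os)) (++⁺ ord ⊆-refl)) pend′ comp′
    where
    pend′ : ∀ {q} → q ∈ p ∷ os → q ∈ R
    pend′ (here refl) = p∈R
    pend′ (there q∈) with pend q∈
    ... | here refl = ⊥-elim (p∉P (Opens-∈ op q∈))
    ... | there q∈R = q∈R
    comp′ : ∀ {q} → q ∈ P ++ [ p ] → q ∈ R → q ∈ p ∷ os
    comp′ q∈ q∈R with ∈-++⁻ P q∈
    ... | inj₁ q∈P = there (comp q∈P (there q∈R))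
    ... | inj₂ (here refl) = here refl

  Opens-second : ∀ {R os p} → p ∉ R → Opens P R os → Opens (P ++ [ p ]) R os
  Opens-second {R} {os} {p} p∉R (opens ord pend comp) = opens (++⁺ʳ _ ord) pend comp′
    where
    comp′ : ∀ {q} → q ∈ P ++ [ p ] → q ∈ R → q ∈ os
    comp′ q∈ q∈R with ∈-++⁻ P q∈
    ... | inj₁ q∈P = comp q∈P q∈R
    ... | inj₂ (here refl) = ⊥-elim (p∉R q∈R)

  -- A locked color counts as closed from the beginning of its lock, although its second sock comes
  -- only after `ws`; it is erased from the remaining input.
  Opens-close : ∀ ws {R os p} → p ∉ os → p ∉ ws ++ R → Opens P (ws ++ p ∷ R) (p ∷ os) → Opens P (ws ++ R) os
  Opens-close ws {R} {os} {p} p∉os p∉ (opens ord pend comp) =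
    opens (⊆-trans (reverse⁺ (p ∷ʳ ⊆-refl {x = os})) ord) pend′ comp′
    where
    pend′ : ∀ {q} → q ∈ os → q ∈ ws ++ R
    pend′ q∈ with ∈-++⁻ ws (pend (there q∈))
    ... | inj₁ q∈ws = ∈-++⁺ˡ q∈ws
    ... | inj₂ (here refl) = ⊥-elim (p∉os q∈)
    ... | inj₂ (there q∈R) = ∈-++⁺ʳ ws q∈R
    comp′ : ∀ {q} → q ∈ P → q ∈ ws ++ R → q ∈ os
    comp′ q∈P q∈ with comp q∈P (wider (∈-++⁻ ws q∈))
      where
      wider : ∀ {q} → q ∈ ws ⊎ q ∈ R → q ∈ ws ++ p ∷ R
      wider (inj₁ q∈ws) = ∈-++⁺ˡ q∈ws
      wider (inj₂ q∈R) = ∈-++⁺ʳ ws (there q∈R)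
    ... | here refl = ⊥-elim (p∉ q∈)
    ... | there q∈os = q∈os

-- `P` has been read, while the bullets may use letters up to `P*`, the word at the end of the
-- current lock. At that point the two agree.
record St {C : Set ℓ} (P* P R : List C) (t : Bool) (os st : List C) : Set ℓ where
  constructor mkSt
  field
    stack : Stack P* R t os st
    seen  : ∀ {p} → p ∈ st → p ∈ P
    op    : Opens P R os

module _ {P* P : List C} where

  pushSingle : ∀ {R t os st p} → p ∉ P → p ∉ R → St P* P (p ∷ R) t os st → St P* (P ++ [ p ]) R true os (p ∷ st)
  pushSingle p∉P p∉R (mkSt stk seen op) =
    mkSt (shut₁ p∉R (p∉P ∘ seen) (Stack-mono ⊆-refl there stk))
         (λ { (here refl) → ∈-++⁺ʳ P (here refl) ; (there q∈) → ∈-++⁺ˡ (seen q∈) })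
         (Opens-single p∉P p∉R op)

  pushFirst : ∀ {R t os st p} → p ∉ P → p ∈ R → (t ≡ true → ∀ {q os′} → os ≡ q ∷ os′ → Bullet P* q p) →
    St P* P (p ∷ R) t os st → St P* (P ++ [ p ]) R false (p ∷ os) (p ∷ st)
  pushFirst p∉P p∈R bul (mkSt stk seen op) =
    mkSt (open₁ (p∉P ∘ seen) bul (Stack-mono ⊆-refl there stk))
         (λ { (here refl) → ∈-++⁺ʳ P (here refl) ; (there q∈) → ∈-++⁺ˡ (seen q∈) })
         (Opens-first p∉P p∈R op)

St-mono : ∀ {P* P′ P R : List C} {t os st} → P* ⊆ P′ → St P* P R t os st → St P′ P R t os st
St-mono τ (mkSt stk seen op) = mkSt (Stack-mono τ (λ p∈ → p∈) stk) seen op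

skipSingle : ∀ {P R : List C} {t os st p} → p ∉ P → p ∉ R → St P P (p ∷ R) t os st → St (P ++ [ p ]) (P ++ [ p ]) R t os st
skipSingle p∉P p∉R (mkSt stk seen op) =
  mkSt (Stack-mono (++⁺ʳ _ ⊆-refl) there stk) (∈-++⁺ˡ ∘ seen) (Opens-single p∉P p∉R op)

readSecond : ∀ {P* P R : List C} {t os st p} → p ∉ R → St P* P R t os st → St P* (P ++ [ p ]) R t os st
readSecond p∉R (mkSt stk seen op) = mkSt stk (∈-++⁺ˡ ∘ seen) (Opens-second p∉R op)

-- A bullet arises between two colors p and q that are pushed while a lock is
-- in force, if something closed separates them.
Supply : {C : Set ℓ} → List C → Bool → List C → List C → Set ℓ
Supply P* true os us = ∀ p os′ q → os ≡ p ∷ os′ → q ∈ us → Bullet P* p q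
Supply P* false os us = ∀ p os′ r q → os ≡ p ∷ os′ → r ∷ q ∷ [] ⊆ us → Bullet P* p q

-- The locked color k occurs before u and again after q. This gives kurqk, the start of family A for
-- n = 2 with α₀ = u, y = r and α₁ = q.
supply-first : ∀ {P* P us os : List C} {k u} → k ∈ P → P ++ u ∷ us ++ [ k ] ⊆ P* → Supply P* false (u ∷ os) us
supply-first {k = k} {u} k∈P τ _ _ _ q refl rq⊆us =
  bullet fA 0 z≤n k _ k (λ _ → q) refl (⊆-trans (++⁺ (from∈ k∈P) (refl ∷ ++⁺ rq⊆us (⊆-refl {x = [ k ]}))) τ)

module _ {C : Set ℓ} (_≟_ : DecidableEquality C) where

  open DecMembership _≟_ using (_∈?_)

  -- Nothing else may be output during the lock of k, so single socks of `us` become bullets.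
  -- `Supply` provides the origin of a bullet as soon as a color opens above it.
  pushes : ∀ {P* P R t os st k} us → New P us → k ∈ P → P ++ us ++ [ k ] ⊆ P* → Supply P* t os us →
    St P* P (us ++ R) t os st → ∃[ t′ ] ∃[ os′ ] St P* (P ++ us) R t′ os′ (us ʳ++ st)
  pushes {P = P} [] new k∈P τ sup st = _ , _ , subst (λ Q → St _ Q _ _ _ _) (sym (++-identityʳ P)) st
  pushes {P* = P*} {P} {R} {t} {os} {st} {k} (u ∷ us) (u∉P ∷ new) k∈P τ sup s =
      subst (λ Q → ∃[ t′ ] ∃[ os′ ] St P* Q R t′ os′ (us ʳ++ u ∷ st)) (++-assoc P [ u ] us) rec
    where
    τ′ : (P ++ [ u ]) ++ us ++ [ k ] ⊆ P*
    τ′ = subst (_⊆ P*) (sym (++-assoc P [ u ] (us ++ [ k ]))) τ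
    sup₁ : t ≡ true → ∀ {q os′} → os ≡ q ∷ os′ → Bullet P* q u
    sup₁ refl os≡ = sup _ _ _ os≡ (here refl)
    sup₂ : ∀ t → Supply P* t os (u ∷ us) → Supply P* true os us
    sup₂ false sup _ _ _ os≡ q∈us = sup _ _ _ _ os≡ (refl ∷ from∈ q∈us)
    sup₂ true sup _ _ _ os≡ q∈us = sup _ _ _ os≡ (there q∈us)
    rec : ∃[ t′ ] ∃[ os′ ] St P* ((P ++ [ u ]) ++ us) R t′ os′ (us ʳ++ u ∷ st)
    rec with u ∈? (us ++ R)
    -- Once u is open, the topmost open color lies within the lock, and `supply-first` takes over.
    ... | yes u∈ = pushes us new (∈-++⁺ˡ k∈P) τ′ (supply-first k∈P τ) (pushFirst u∉P u∈ sup₁ s)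
    ... | no u∉ = pushes us new (∈-++⁺ˡ k∈P) τ′ (sup₂ t sup) (pushSingle u∉P u∉ s)

  split : ∀ P R → New P R ⊎ ∃[ ws ] ∃[ k ] ∃[ R′ ] R ≡ ws ++ k ∷ R′ × New P ws × (k ∈ P ⊎ k ∈ ws)
  split P [] = inj₁ []
  split P (p ∷ R) with p ∈? P
  ... | yes p∈P = inj₂ ([] , p , R , refl , [] , inj₁ p∈P)
  ... | no p∉P with split (P ++ [ p ]) R
  ... | inj₁ new = inj₁ (p∉P ∷ new)
  ... | inj₂ (ws , k , R′ , refl , new , inj₂ k∈ws) = inj₂ (p ∷ ws , k , R′ , refl , p∉P ∷ new , inj₂ (there k∈ws))
  ... | inj₂ (ws , k , R′ , refl , new , inj₁ k∈) with ∈-++⁻ P k∈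
  ... | inj₁ k∈P = inj₂ (p ∷ ws , k , R′ , refl , p∉P ∷ new , inj₁ k∈P)
  ... | inj₂ (here refl) = inj₂ (p ∷ ws , k , R′ , refl , p∉P ∷ new , inj₂ (here refl))

  -- The greedy rule that complete colors leave the top of the stack at once.
  normalise : ∀ {P R : List C} {t os st} → St P P R t os st → ∃[ st′ ] St P P R false os st′ × (Sorts R st′ → Sorts R st)
  normalise s@(mkSt [] _ _) = _ , s , λ r → r
  normalise s@(mkSt (open₁ _ _ _) _ _) = _ , s , λ r → r
  normalise (mkSt (shut₁ p∉R p∉st stk) seen op) =
    let st′ , s , k = normalise (mkSt stk (seen ∘ there) op) in st′ , s , pop₁ p∉R p∉st ∘ k
  normalise (mkSt (shut₂ p∉R p∉st stk) seen op) =
    let st′ , s , k = normalise (mkSt stk (seen ∘ there ∘ there) op) in st′ , s , pop₂ p∉R p∉st ∘ k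

-- One round of the greedy strategy

length-suffix : (l : List C) (p : C) (l′ : List C) → length l′ < length (l ++ p ∷ l′)
length-suffix l p l′ = length-mono-≤ (++⁺ˡ l (⊆-refl {x = p ∷ l′}))

module Greedy {C : Set ℓ} (_≟_ : DecidableEquality C) {s : List C} (nt : NoTriple s) where

  open DecMembership _≟_ using (_∈?_)

  at : ∀ {P R l l′} → P ++ R ≡ s → l ⊆ P → l′ ⊆ R → l ++ l′ ⊆ s
  at eq σ τ = subst (_ ⊆_) eq (++⁺ σ τ)

  twice-before : ∀ {P R p} → P ++ R ≡ s → p ∷ p ∷ [] ⊆ P → p ∉ R
  twice-before eq pp p∈R = nt (at eq pp (from∈ p∈R))

  twice-after : ∀ {P R p} → P ++ R ≡ s → p ∈ P → ¬ p ∷ p ∷ [] ⊆ R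
  twice-after eq p∈P pp = nt (at eq (from∈ p∈P) pp)

  Opens-unique : ∀ {P R os p} → P ++ R ≡ s → Opens P R os → ¬ p ∷ p ∷ [] ⊆ os
  Opens-unique eq op pp =
    twice-before eq (⊆-trans (reverse⁺ pp) (Opens.ordered op)) (Opens.pending op (to∈ (∷ˡ⁻ pp)))

  snoc-eq : ∀ {P R} p → P ++ p ∷ R ≡ s → (P ++ [ p ]) ++ R ≡ s
  snoc-eq {P} {R} p = trans (++-assoc P [ p ] R)

  -- The situation just after the second sock of the color `last`.
  record After (R₀ st₀ : List C) : Set ℓ where
    constructor after
    field
      {P R os stk} : List C
      {last}  : C
      {t}     : Bool
      split≡  : (P ++ [ last ]) ++ R ≡ s
      last∈   : last ∈ P
      state   : St (P ++ [ last ]) (P ++ [ last ]) R t os stk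
      before  : reverse os ⊆ P
      shorter : length R < length R₀
      sorts   : Sorts R stk → Sorts R₀ st₀

  After-trans : ∀ {R st R₀ st₀} → (length R ≤ length R₀) → (Sorts R st → Sorts R₀ st₀) → After R st → After R₀ st₀
  After-trans R≤ k (after eq last∈ state before shorter sorts) =
    after eq last∈ state before (≤-trans shorter R≤) (k ∘ sorts)

  skipSingles : ∀ {P R : List C} {t} {os st : List C} ws → New P ws → (∀ {p} → p ∈ ws → p ∉ R) → St P P (ws ++ R) t os st →
    St (P ++ ws) (P ++ ws) R t os st × (Sorts R st → Sorts (ws ++ R) st)
  skipSingles {P} [] new single st = subst (λ Q → St Q Q _ _ _ _) (sym (++-identityʳ P)) st , λ r → r
  skipSingles {P} {R} (p ∷ ws) new@(p∉P ∷ new′) single st@(mkSt _ seen _) =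
    let p∉ = λ p∈ → case ∈-++⁻ ws p∈ of λ { (inj₁ p∈ws) → New-head new p∈ws ; (inj₂ p∈R) → single (here refl) p∈R }
        st′ , k = skipSingles ws new′ (single ∘ there) (skipSingle p∉P p∉ st)
    in subst (λ Q → St Q Q _ _ _ _) (++-assoc P [ p ] ws) st′ , put ∘ pop₁ p∉ (p∉P ∘ seen) ∘ k

  -- Single socks pass through the stack before the lock begins, so that they
  -- separate nothing.
  atTop : ∀ {P k R os st} ws → New P ws → P ++ ws ++ k ∷ R ≡ s → St P P (ws ++ k ∷ R) false (k ∷ os) (k ∷ st) →
    After (ws ++ k ∷ R) (k ∷ st)
  atTop {P} {k} {R} [] new eq (mkSt (open₁ k∉st bul stk) seen op) =
    after (snoc-eq k eq) (Opens-∈ op (here refl))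
      (readSecond k∉R (mkSt (Stack-mono (++⁺ʳ [ k ] ⊆-refl) there stk) (seen ∘ there) op′))
      (Opens.ordered op′) ≤-refl (put ∘ pop₂ k∉R k∉st)
    where
    k∉R : k ∉ R
    k∉R k∈R = twice-after eq (Opens-∈ op (here refl)) (refl ∷ from∈ k∈R)
    op′ = Opens-close [] (λ k∈os → Opens-unique eq op (refl ∷ from∈ k∈os)) k∉R op
  atTop {P} {k} {R} (p ∷ ws) new@(p∉P ∷ new′) eq st@(mkSt (open₁ {t} {os} k∉st bul stk) seen op) with p ∈? (ws ++ k ∷ R)
  ... | no p∉ =
    After-trans (n≤1+n _) (put ∘ pop₁ p∉ (p∉P ∘ seen))
      (atTop ws new′ (trans (++-assoc P [ p ] _) eq) (skipSingle p∉P p∉ st))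
  -- The color p is the first of the remaining input that stays open, so the lock of k begins here.
  ... | yes p∈ =
    let t′ , os′ , mkSt stk′ seen′ op″ =
                pushes _≟_ ws new′ (∈-++⁺ˡ k∈P)
                (⊆-reflexive (trans (++-assoc P [ p ] _) (sym (++-assoc P (p ∷ ws) [ k ]))))
                          (supply-first k∈P P*) (pushFirst p∉P p∈′ bul′ st₁)
    in after (trans (++-assoc (P ++ p ∷ ws) [ k ] R) (trans (++-assoc P (p ∷ ws) (k ∷ R)) eq)) (∈-++⁺ˡ k∈P)
        (readSecond k∉R (subst (λ Q → St ((P ++ p ∷ ws) ++ [ k ]) Q R t′ os′ _) (++-assoc P [ p ] ws) (mkSt stk′ seen′ op″)))
        (subst (reverse os′ ⊆_) (++-assoc P [ p ] ws) (Opens.ordered op″))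
        (length-suffix (p ∷ ws) k R)
        (lock k∉R k∉ws (k∉st))
    where
    k∈P : k ∈ P
    k∈P = Opens-∈ op (here refl)
    P* : P ++ p ∷ ws ++ [ k ] ⊆ (P ++ p ∷ ws) ++ [ k ]
    P* = ⊆-reflexive (sym (++-assoc P (p ∷ ws) [ k ]))
    k∉R : k ∉ R
    k∉R k∈R = twice-after eq k∈P (++⁺ˡ (p ∷ ws) (refl ∷ from∈ k∈R))
    k∉ws : k ∉ p ∷ ws
    k∉ws k∈ws = New-∉ new k∈ws k∈P
    k∉ : k ∉ p ∷ ws ++ R
    k∉ k∈ with ∈-++⁻ (p ∷ ws) k∈
    ... | inj₁ k∈ws = k∉ws k∈ws
    ... | inj₂ k∈R = k∉R k∈R
    p∈′ : p ∈ ws ++ R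
    p∈′ with ∈-++⁻ ws p∈
    ... | inj₁ p∈ws = ∈-++⁺ˡ p∈ws
    ... | inj₂ (here refl) = ⊥-elim (k∉ws (here refl))
    ... | inj₂ (there p∈R) = ∈-++⁺ʳ ws p∈R
    bul′ : t ≡ true → ∀ {q os′} → os ≡ q ∷ os′ → Bullet ((P ++ p ∷ ws) ++ [ k ]) q p
    -- A bullet between q and k is handed down to q and p by the letters p and k.
    bul′ t≡ os≡ = Bullet-extend (bul t≡ os≡)
      (⊆-trans (++⁺ (⊆-refl {x = P}) (refl ∷ ++⁺ˡ ws ⊆-refl)) P*)
    widen : ∀ {q} → q ∈ p ∷ ws ++ R → q ∈ p ∷ ws ++ k ∷ R
    widen q∈ with ∈-++⁻ (p ∷ ws) q∈
    ... | inj₁ q∈ws = ∈-++⁺ˡ q∈ws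
    ... | inj₂ q∈R = ∈-++⁺ʳ (p ∷ ws) (there q∈R)
    st₁ : St ((P ++ p ∷ ws) ++ [ k ]) P (p ∷ ws ++ R) t os _
    st₁ = mkSt (Stack-mono (⊆-trans (++⁺ʳ (p ∷ ws) ⊆-refl) (++⁺ʳ [ k ] ⊆-refl)) widen stk) (seen ∘ there)
      (Opens-close (p ∷ ws) (λ k∈os → Opens-unique eq op (refl ∷ from∈ k∈os)) k∉ op)

  -- The first sock of k lies in `ws`. Up to it, colors that stay open are pushed and single socks
  -- pass through; then k is on top.
  ahead : ∀ {P k R os st} ws → New P ws → k ∈ ws → P ++ ws ++ k ∷ R ≡ s → St P P (ws ++ k ∷ R) false os st →
    After (ws ++ k ∷ R) st
  ahead {P} {k} {R} (p ∷ ws) (p∉P ∷ new) k∈ eq st@(mkSt _ seen _) = by-cases k∈ (p ∈? (ws ++ k ∷ R))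
    where
    eq′ : (P ++ [ p ]) ++ ws ++ k ∷ R ≡ s
    eq′ = snoc-eq p eq
    pushed : ∀ {os} {st} → p ∈ ws ++ k ∷ R → St P P (p ∷ ws ++ k ∷ R) false os st →
      St (P ++ [ p ]) (P ++ [ p ]) (ws ++ k ∷ R) false (p ∷ os) (p ∷ st)
    pushed p∈ st = St-mono (++⁺ʳ [ p ] ⊆-refl) (pushFirst p∉P p∈ (λ ()) st)
    by-cases : k ∈ p ∷ ws → Dec (p ∈ ws ++ k ∷ R) → After (p ∷ ws ++ k ∷ R) _
    by-cases (here refl) _ =
      After-trans (n≤1+n _) put (atTop ws new eq′ (pushed (∈-++⁺ʳ ws (here refl)) st))
    by-cases (there k∈ws) (yes p∈) = After-trans (n≤1+n _) put (ahead ws new k∈ws eq′ (pushed p∈ st))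
    by-cases (there k∈ws) (no p∉) =
      After-trans (n≤1+n _) (put ∘ pop₁ p∉ (p∉P ∘ seen)) (ahead ws new k∈ws eq′ (skipSingle p∉P p∉ st))

  -- Applied where another p follows L: if p ends L, two equal socks are adjacent, and otherwise a
  -- letter t separates them.
  gap : ∀ {l L : List C} {p} → l ++ [ p ] ⊆ L → (∃[ t ] l ++ p ∷ t ∷ [] ⊆ L) ⊎ (∃[ L′ ] L ≡ L′ ++ [ p ])
  gap {[]} {p ∷ []} (refl ∷ []) = inj₂ ([] , refl)
  gap {[]} {p ∷ t ∷ L} (refl ∷ τ) = inj₁ (t , refl ∷ refl ∷ minimum L)
  gap {q ∷ l} (refl ∷ τ) with gap {l} τ
  ... | inj₁ (t , υ) = inj₁ (t , refl ∷ υ)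
  ... | inj₂ (L′ , refl) = inj₂ (q ∷ L′ , refl)
  gap {l} (_ ∷ʳ τ) with gap {l} τ
  ... | inj₁ (t , υ) = inj₁ (t , _ ∷ʳ υ)
  ... | inj₂ (L′ , refl) = inj₂ (_ ∷ L′ , refl)

  order : ∀ {L : List C} {u v} → u ≢ v → u ∈ L → v ∈ L → u ∷ v ∷ [] ⊆ L ⊎ v ∷ u ∷ [] ⊆ L
  order u≢v u∈ v∈ with insert (from∈ u∈) v∈
  ... | inj₁ (here refl) = ⊥-elim (u≢v refl)
  ... | inj₂ ([] , _ , refl , τ) = inj₂ τ
  ... | inj₂ (_ ∷ [] , _ , refl , τ) = inj₁ τ

  -- Obstructions to the greedy strategy

  module _ (na : ∀ l p r → l ++ p ∷ p ∷ r ≢ s) where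

    -- The two socks of color p are not adjacent, which is where t comes from.
    place₂ : ∀ {P R p u v} → (P ++ [ p ]) ++ R ≡ s → p ∈ P → p ∉ u ∷ v ∷ [] → u ∷ v ∷ [] ⊆ P →
        p ∷ u ∷ v ∷ p ∷ [] ⊆ P ++ [ p ]
      ⊎ u ∷ p ∷ v ∷ p ∷ [] ⊆ P ++ [ p ]
      ⊎ ∃[ t ] u ∷ v ∷ p ∷ t ∷ p ∷ [] ⊆ P ++ [ p ] × t ∈ P
    place₂ {P} {R} {p} {u} {v} eq p∈ p∉ τ with insert τ p∈
    ... | inj₁ p∈l = ⊥-elim (p∉ p∈l)
    ... | inj₂ ([] , _ , refl , υ) = inj₁ (++⁺ υ ⊆-refl)
    ... | inj₂ (_ ∷ [] , _ , refl , υ) = inj₂ (inj₁ (++⁺ υ ⊆-refl))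
    ... | inj₂ (_ ∷ _ ∷ [] , [] , refl , υ) with gap {u ∷ v ∷ []} υ
    ... | inj₁ (t , ω) = inj₂ (inj₂ (t , ++⁺ ω ⊆-refl , to∈ (∷ˡ⁻ (∷ˡ⁻ (∷ˡ⁻ ω)))))
    ... | inj₂ (L , refl) =
        ⊥-elim (na L p R (trans (sym (++-assoc L [ p ] _)) (trans (sym (++-assoc (L ++ [ p ]) [ p ] R)) eq)))

    place₃ : ∀ {P R p u v w} → (P ++ [ p ]) ++ R ≡ s → p ∈ P → p ∉ u ∷ v ∷ w ∷ [] → u ∷ v ∷ w ∷ [] ⊆ P →
        p ∷ u ∷ v ∷ w ∷ p ∷ [] ⊆ P ++ [ p ]
      ⊎ u ∷ p ∷ v ∷ w ∷ p ∷ [] ⊆ P ++ [ p ]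
      ⊎ u ∷ v ∷ p ∷ w ∷ p ∷ [] ⊆ P ++ [ p ]
      ⊎ ∃[ t ] u ∷ v ∷ w ∷ p ∷ t ∷ p ∷ [] ⊆ P ++ [ p ]
    place₃ {P} {R} {p} {u} {v} {w} eq p∈ p∉ τ with insert τ p∈
    ... | inj₁ p∈l = ⊥-elim (p∉ p∈l)
    ... | inj₂ ([] , _ , refl , υ) = inj₁ (++⁺ υ ⊆-refl)
    ... | inj₂ (_ ∷ [] , _ , refl , υ) = inj₂ (inj₁ (++⁺ υ ⊆-refl))
    ... | inj₂ (_ ∷ _ ∷ [] , _ , refl , υ) = inj₂ (inj₂ (inj₁ (++⁺ υ ⊆-refl)))
    ... | inj₂ (_ ∷ _ ∷ _ ∷ [] , [] , refl , υ) with gap {u ∷ v ∷ w ∷ []} υ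
    ... | inj₁ (t , ω) = inj₂ (inj₂ (inj₂ (t , ++⁺ ω ⊆-refl)))
    ... | inj₂ (L , refl) =
        ⊥-elim (na L p R (trans (sym (++-assoc L [ p ] _)) (trans (sym (++-assoc (L ++ [ p ]) [ p ] R)) eq)))

    -- The second sock of p has just been read, and k is the color of the next one. The colors
    -- already open precede that second sock, so only the place of the first sock of p among theirs
    -- is unknown; it selects the listed word.
    module Deep {P p k R} (ws : List C) (eq : (P ++ [ p ]) ++ ws ++ k ∷ R ≡ s) (p∈P : p ∈ P) where

      p∉ : ∀ {l} → (∀ {q} → q ∈ l → q ∈ ws ++ k ∷ R) → p ∉ l
      p∉ later p∈l = twice-before eq (++⁺ (from∈ p∈P) ⊆-refl) (later p∈l)

      k∈later : k ∈ ws ++ k ∷ R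
      k∈later = ∈-++⁺ʳ ws (here refl)

      later : ∀ {q} → q ∈ R → q ∈ ws ++ k ∷ R
      later q∈R = ∈-++⁺ʳ ws (there q∈R)

      -- Two open colors lie above k, so one lock does not give access to it. The place of p and the
      -- order in which u and v return decide the word.
      threeOpen : ∀ {u v} → k ∷ u ∷ v ∷ [] ⊆ P → u ∈ R → v ∈ R → Contains s
      threeOpen {u} {v} τ u∈R v∈R with order u≢v u∈R v∈R |
          place₃ eq p∈P (p∉ λ { (here refl) → k∈later ; (there (here refl)) →
          later u∈R ; (there (there (here refl))) → later v∈R }) τ
        where
        u≢v : u ≢ v
        u≢v refl = twice-before eq (++⁺ʳ [ p ] (∷ˡ⁻ τ)) (later u∈R)
      ... | inj₁ uv | inj₁ υ =
        contains-A nt (⊆-trans (refl ∷ refl ∷ refl ∷ refl ∷ refl ∷ refl ∷ u ∷ʳ refl ∷ []) (at eq υ (++⁺ˡ ws (refl ∷ uv))))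
      ... | inj₁ uv | inj₂ (inj₁ υ) =
        contains-word nt (a ∷ d ∷ b ∷ c ∷ d ∷ a ∷ b ∷ c ∷ []) (# 0) (palette a d b c a a) (palette k u v p p p)
            (at eq υ (++⁺ˡ ws (refl ∷ uv)))
      ... | inj₁ uv | inj₂ (inj₂ (inj₁ υ)) =
        contains-A nt (⊆-trans (refl ∷ refl ∷ refl ∷ refl ∷ p ∷ʳ refl ∷ refl ∷ refl ∷ []) (at eq υ (++⁺ˡ ws (refl ∷ uv))))
      ... | inj₁ uv | inj₂ (inj₂ (inj₂ (t , υ))) =
        contains-word nt (a ∷ b ∷ c ∷ d ∷ e ∷ d ∷ a ∷ b ∷ c ∷ []) (# 1) (palette a b c d e a)
            (palette k u v p t p) (at eq υ (++⁺ˡ ws (refl ∷ uv)))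
      ... | inj₂ vu | inj₁ υ =
        contains-A nt (⊆-trans (refl ∷ refl ∷ refl ∷ refl ∷ refl ∷ refl ∷ refl ∷ u ∷ʳ []) (at eq υ (++⁺ˡ ws (refl ∷ vu))))
      ... | inj₂ vu | inj₂ (inj₁ υ) =
        contains-word nt (a ∷ d ∷ b ∷ c ∷ d ∷ a ∷ c ∷ b ∷ []) (# 4) (palette a d b c a a) (palette k u v p p p)
            (at eq υ (++⁺ˡ ws (refl ∷ vu)))
      ... | inj₂ vu | inj₂ (inj₂ (inj₁ υ)) =
        contains-word nt (a ∷ b ∷ d ∷ c ∷ d ∷ a ∷ c ∷ b ∷ []) (# 5) (palette a b d c a a) (palette k u v p p p)
            (at eq υ (++⁺ˡ ws (refl ∷ vu)))
      ... | inj₂ vu | inj₂ (inj₂ (inj₂ (t , υ))) =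
        contains-word nt (a ∷ b ∷ c ∷ d ∷ e ∷ d ∷ a ∷ c ∷ b ∷ []) (# 7) (palette a b c d e a)
            (palette k u v p t p) (at eq υ (++⁺ˡ ws (refl ∷ vu)))

      -- The color w opens after the second sock of p and blocks k together with v.
      newOpen : ∀ {v w} → k ∷ v ∷ [] ⊆ P → v ∈ R → w ∈ ws → w ∈ R → w ≢ v → Contains s
      newOpen {v} {w} τ v∈R w∈ws w∈R w≢v with order w≢v w∈R v∈R
      ... | inj₂ vw = contains-A nt (at eq (++⁺ τ (⊆-refl {x = [ p ]})) (++⁺ (from∈ w∈ws) (refl ∷ vw)))
      ... | inj₁ wv with place₂ eq p∈P (p∉ λ { (here refl) → k∈later ; (there (here refl)) → later v∈R }) τ
      ... | inj₁ υ = contains-word nt (d ∷ a ∷ b ∷ d ∷ c ∷ a ∷ c ∷ b ∷ []) (# 2) (palette d a b c a a) (palette k v w p p p)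
                       (at eq υ (++⁺ (from∈ w∈ws) (refl ∷ wv)))
      ... | inj₂ (inj₁ υ) =
          contains-word nt (a ∷ d ∷ b ∷ d ∷ c ∷ a ∷ c ∷ b ∷ []) (# 3) (palette a d b c a a) (palette k v w p p p)
                       (at eq υ (++⁺ (from∈ w∈ws) (refl ∷ wv)))
      ... | inj₂ (inj₂ (t , υ , _)) =
          contains-word nt (a ∷ b ∷ d ∷ e ∷ d ∷ c ∷ a ∷ c ∷ b ∷ []) (# 6) (palette a b d e c a) (palette k v w p t p)
                       (at eq υ (++⁺ (from∈ w∈ws) (refl ∷ wv)))

      -- The color q lies below k and returns after k but before v, hence during the lock of v that
      -- k requires.
      otherOld : ∀ {q v} → q ∷ k ∷ v ∷ [] ⊆ P → q ∷ v ∷ [] ⊆ R → Contains s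
      otherOld {q} {v} τ qv with place₃ eq p∈P
          (p∉ λ { (here refl) → later (to∈ qv) ; (there (here refl)) → k∈later ; (there (there (here refl))) →
          later (to∈ (∷ˡ⁻ qv)) }) τ
      ... | inj₁ υ = contains-A nt
          (⊆-trans (refl ∷ refl ∷ refl ∷ refl ∷ refl ∷ k ∷ʳ refl ∷ refl ∷ []) (at eq υ (++⁺ˡ ws (refl ∷ qv))))
      ... | inj₂ (inj₁ υ) =
          contains-word nt (c ∷ d ∷ a ∷ b ∷ d ∷ a ∷ c ∷ b ∷ []) (# 8) (palette c d a b a a)
          (palette k v q p p p) (at eq υ (++⁺ˡ ws (refl ∷ qv)))
      ... | inj₂ (inj₂ (inj₁ υ)) =
          contains-word nt (c ∷ a ∷ d ∷ b ∷ d ∷ a ∷ c ∷ b ∷ []) (# 9) (palette c a d b a a)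
          (palette k v q p p p) (at eq υ (++⁺ˡ ws (refl ∷ qv)))
      ... | inj₂ (inj₂ (inj₂ (t , υ))) =
          contains-word nt (c ∷ a ∷ b ∷ d ∷ e ∷ d ∷ a ∷ c ∷ b ∷ []) (# 10) (palette c a b d e a)
          (palette k v q p t p) (at eq υ (++⁺ˡ ws (refl ∷ qv)))

      -- Both socks of q arrive during the lock of v that k requires, and u keeps them apart.
      otherNew : ∀ {q u v} → k ∷ v ∷ [] ⊆ P → q ∷ u ∷ q ∷ v ∷ [] ⊆ R → u ∉ P → Contains s
      otherNew {q} {u} {v} τ quqv u∉P with place₂ eq p∈P
          (p∉ λ { (here refl) → k∈later ; (there (here refl)) → later (to∈ (∷ˡ⁻ (∷ˡ⁻ (∷ˡ⁻ quqv)))) }) τ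
      ... | inj₁ υ = contains-word nt (d ∷ a ∷ b ∷ d ∷ a ∷ c ∷ f ∷ c ∷ b ∷ []) (# 11) (palette d a b c f a)
          (palette k v q p p u) (at eq υ (++⁺ˡ ws (refl ∷ quqv)))
      ... | inj₂ (inj₁ υ) =
          contains-word nt (a ∷ d ∷ b ∷ d ∷ a ∷ c ∷ f ∷ c ∷ b ∷ []) (# 12) (palette a d b c f a)
          (palette k v q p p u) (at eq υ (++⁺ˡ ws (refl ∷ quqv)))
      -- Here t and u take the places of the two colors that occur once in the last sporadic word;
      -- they differ because t lies in P and u does not.
      ... | inj₂ (inj₂ (t , υ , t∈P)) =
          contains-last nt (palette k v p t q u) (λ { refl → u∉P t∈P }) (at eq υ (++⁺ˡ ws (refl ∷ quqv)))

    -- The situation in which k lies directly under v and only single socks come before it; q is the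
    -- color of the next second sock after k.
    module Under {P p k v q R′ os} (ws us : List C) (new : New (P ++ [ p ]) ws)
        (new₂ : New (((P ++ [ p ]) ++ ws) ++ [ k ]) us)
      (eq : (P ++ [ p ]) ++ ws ++ k ∷ us ++ q ∷ R′ ≡ s) (p∈ : p ∈ P) (before : reverse (v ∷ k ∷ os) ⊆ P)
      (op : Opens (P ++ [ p ]) (ws ++ k ∷ us ++ q ∷ R′) (v ∷ k ∷ os)) (v∈R : v ∈ us ++ q ∷ R′)
      (singles : ∀ {r} → r ∈ ws → r ∉ us ++ q ∷ R′) where

      open Deep ws eq p∈

      P₁ P₂ : List C
      P₁ = (P ++ [ p ]) ++ ws
      P₂ = P₁ ++ [ k ]

      k∈P : k ∈ P ++ [ p ]
      k∈P = Opens-∈ op (there (here refl))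

      v∈P : v ∈ P ++ [ p ]
      v∈P = Opens-∈ op (here refl)

      other : q ∈ P₂ ⊎ q ∈ us → q ≢ v → Contains s
      other q∈ q≢v = go q∈
        where
        v∈R′ : v ∈ R′
        v∈R′ with ∈-++⁻ us v∈R
        ... | inj₁ v∈us = ⊥-elim (New-∉ new₂ v∈us (∈-++⁺ˡ (∈-++⁺ˡ v∈P)))
        ... | inj₂ (here refl) = ⊥-elim (q≢v refl)
        ... | inj₂ (there v∈R′) = v∈R′
        kv : k ∷ v ∷ [] ⊆ P
        kv = ⊆-trans (reverse⁺ {as = v ∷ k ∷ []} (refl ∷ refl ∷ minimum os)) before
        old : q ∈ P ++ [ p ] → Contains s
        old q∈ with Opens.complete op q∈ (later (∈-++⁺ʳ us (here refl)))
        ... | here q≡v = ⊥-elim (q≢v q≡v)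
        ... | there (here refl) = ⊥-elim (twice-after eq k∈P (++⁺ˡ ws (refl ∷ ++⁺ˡ us (refl ∷ minimum R′))))
        ... | there (there q∈os) =
            otherOld (⊆-trans (reverse⁺ {as = v ∷ k ∷ q ∷ []} (refl ∷ refl ∷ from∈ q∈os)) before)
            (++⁺ˡ us (refl ∷ from∈ v∈R′))
        go : q ∈ P₂ ⊎ q ∈ us → Contains s
        go (inj₁ q∈) with ∈-++⁻ P₁ q∈
        ... | inj₂ (here refl) = old k∈P
        ... | inj₁ q∈ with ∈-++⁻ (P ++ [ p ]) q∈
        ... | inj₁ q∈P = old q∈P
        ... | inj₂ q∈ws = ⊥-elim (singles q∈ws (∈-++⁺ʳ us (here refl)))
        -- Both socks of q come after k; not being adjacent, they have a letter r between them.
        go (inj₂ q∈us) with gap {[]} (from∈ q∈us)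
        ... | inj₁ (r , qr) = otherNew kv (++⁺ qr (refl ∷ from∈ v∈R′)) λ r∈P →
            New-∉ new₂ (to∈ (∷ˡ⁻ qr)) (∈-++⁺ˡ (∈-++⁺ˡ (∈-++⁺ˡ r∈P)))
        ... | inj₂ (L , refl) = ⊥-elim (na ((P ++ [ p ]) ++ ws ++ k ∷ L) q R′
                (trans (++-assoc (P ++ [ p ]) (ws ++ k ∷ L) (q ∷ q ∷ R′))
                (trans (cong ((P ++ [ p ]) ++_)
                    (trans (++-assoc ws (k ∷ L) (q ∷ q ∷ R′))
                    (cong (λ l → ws ++ k ∷ l) (sym (++-assoc L [ q ] (q ∷ R′)))))) eq)))

      v∉kos : v ∉ k ∷ os
      v∉kos v∈ = Opens-unique eq op (refl ∷ from∈ v∈)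

      k∉os : k ∉ os
      k∉os k∈ = Opens-unique eq op (v ∷ʳ refl ∷ from∈ k∈)

      -- The socks of k meet while v is locked, and stay on the stack below us.
      lockTop : ∀ {st t} → q ≡ v → v ∉ k ∷ st → k ∉ st → Stack (P ++ [ p ]) (ws ++ k ∷ us ++ q ∷ R′) t os st →
        Stack (P ++ [ p ]) (ws ++ k ∷ us ++ q ∷ R′) false (v ∷ k ∷ os) (v ∷ k ∷ st) →
        (∀ {r} → r ∈ v ∷ k ∷ st → r ∈ P ++ [ p ]) → After (ws ++ k ∷ us ++ q ∷ R′) (v ∷ k ∷ st)
      lockTop {st} refl v∉st k∉st stk₂ stk seen =
        let st₁ , sorts₁ = skipSingles ws new
                    (λ q∈ws → λ { (here refl) → New-∉ new q∈ws k∈P ; (there q∈R) → singles q∈ws q∈R })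
                    (mkSt stk seen op)
            -- First v is closed, from the beginning of its lock, and then k.
            op₂ = Opens-second k∉′ (Opens-close [] k∉os k∉′ (Opens-close (k ∷ us) v∉kos v∉′ (St.op st₁)))
            st₃ : St P* P₂ (us ++ R′) true os (k ∷ k ∷ st)
            st₃ = mkSt (shut₂ k∉′ k∉st (Stack-mono P⊆ widen stk₂))
                       (λ { (here refl) → ∈-++⁺ˡ (∈-++⁺ˡ k∈P)
                          ; (there (here refl)) → ∈-++⁺ˡ (∈-++⁺ˡ k∈P)
                          ; (there (there q∈)) → ∈-++⁺ˡ (∈-++⁺ˡ (seen (there (there q∈)))) }) op₂
            t′ , os′ , st₄ = pushes _≟_ us new₂ (∈-++⁺ˡ (∈-++⁺ˡ v∈P)) (⊆-reflexive (sym (++-assoc P₂ us [ v ]))) supply st₃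
        in after eq₂ (∈-++⁺ˡ (∈-++⁺ˡ (∈-++⁺ˡ v∈P))) (readSecond v∉R′ st₄) (Opens.ordered (St.op st₄))
             (≤-trans (length-suffix us v R′) (≤-trans (n≤1+n _) (length-mono-≤ (++⁺ˡ ws (⊆-refl {x = k ∷ us ++ v ∷ R′})))))
             (sorts₁ ∘ lock {us = k ∷ us} v∉R′ v∉us′ v∉st)
        where
        P* = (P₂ ++ us) ++ [ v ]
        P⊆ : P ++ [ p ] ⊆ P*
        P⊆ = ++⁺ʳ [ v ] (++⁺ʳ us (++⁺ʳ [ k ] (++⁺ʳ ws ⊆-refl)))
        k∉′ : k ∉ us ++ R′
        k∉′ k∈ with ∈-++⁻ us k∈
        ... | inj₁ k∈us = New-∉ new₂ k∈us (∈-++⁺ʳ P₁ (here refl))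
        ... | inj₂ k∈R′ = twice-after eq k∈P (++⁺ˡ ws (refl ∷ ++⁺ˡ us (v ∷ʳ from∈ k∈R′)))
        v∉R′ : v ∉ R′
        v∉R′ v∈R′ = twice-after eq v∈P (++⁺ˡ ws (k ∷ʳ ++⁺ˡ us (refl ∷ from∈ v∈R′)))
        v∉us′ : v ∉ k ∷ us
        v∉us′ (here refl) = v∉kos (here refl)
        v∉us′ (there v∈us) = New-∉ new₂ v∈us (∈-++⁺ˡ (∈-++⁺ˡ v∈P))
        v∉′ : v ∉ k ∷ us ++ R′
        v∉′ v∈ with ∈-++⁻ (k ∷ us) v∈
        ... | inj₁ v∈us = v∉us′ v∈us
        ... | inj₂ v∈R′ = v∉R′ v∈R′
        widen : ∀ {q} → q ∈ us ++ R′ → q ∈ ws ++ k ∷ us ++ v ∷ R′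
        widen q∈ with ∈-++⁻ us q∈
        ... | inj₁ q∈us = ∈-++⁺ʳ ws (there (∈-++⁺ˡ q∈us))
        ... | inj₂ q∈R′ = ∈-++⁺ʳ ws (there (∈-++⁺ʳ us (there q∈R′)))
        eq₂ : ((P₂ ++ us) ++ [ v ]) ++ R′ ≡ s
        eq₂ = trans (++-assoc (P₂ ++ us) [ v ] R′)
            (trans (++-assoc P₂ us (v ∷ R′)) (trans (++-assoc P₁ [ k ] _) (trans (++-assoc (P ++ [ p ]) ws _) eq)))
        embed : ∀ {l r} → r ∈ us → l ⊆ P ++ [ p ] → ((l ++ [ k ]) ++ [ r ]) ++ [ v ] ⊆ P*
        embed r∈us υ = ++⁺ (++⁺ (++⁺ (++⁺ʳ ws υ) ⊆-refl) (from∈ r∈us)) ⊆-refl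
        -- The bullet is k itself. With α₀ = q, α₁ = r and α₂ = v, the four places of the first sock
        -- of p give the starts of A, B, B′ and C for n = 3, followed by α₁α₂.
        supply : Supply P* true os us
        supply q os′ r refl r∈us with place₃ eq p∈
            (p∉ λ { (here refl) → Opens.pending op (there (there (here refl))) ; (there (here refl)) →
                k∈later ; (there (there (here refl))) → later v∈R })
            (⊆-trans (reverse⁺ {as = v ∷ k ∷ q ∷ []} (refl ∷ refl ∷ refl ∷ minimum os′)) before)
        ... | inj₁ υ = bullet fA 1 z≤n p k p (cons r (λ _ → v)) refl
                (⊆-trans (refl ∷ refl ∷ refl ∷ refl ∷ refl ∷ k ∷ʳ refl ∷ refl ∷ []) (embed r∈us υ))
        ... | inj₂ (inj₁ υ) = bullet fB 1 (s≤s z≤n) p k p (cons r (λ _ → v)) refl (embed r∈us υ)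
        ... | inj₂ (inj₂ (inj₁ υ)) = bullet fB′ 1 (s≤s z≤n) p k p (cons r (λ _ → v)) refl (embed r∈us υ)
        ... | inj₂ (inj₂ (inj₂ (t , υ))) = bullet fC 1 (s≤s z≤n) k p t (cons r (λ _ → v)) refl (embed r∈us υ)

      -- If a bullet separates k from v, the second socks of k and v play α₀α₁ and complete the
      -- family word of that bullet. Otherwise v can be locked.
      closeUp : ∀ {st t} → q ≡ v → v ∉ st → (t ≡ true → ∀ {r os′} → k ∷ os ≡ r ∷ os′ → Bullet (P ++ [ p ]) r v) →
        Stack (P ++ [ p ]) (ws ++ k ∷ us ++ q ∷ R′) t (k ∷ os) st → (∀ {r} → r ∈ v ∷ st → r ∈ P ++ [ p ]) →
        After (ws ++ k ∷ us ++ q ∷ R′) (v ∷ st) ⊎ Contains s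
      closeUp {t = true} refl v∉st bul stk seen = inj₂ (Bullet-close nt (bul refl refl)
        (at eq ⊆-refl (++⁺ˡ ws (refl ∷ ++⁺ˡ us (refl ∷ minimum _)))))
      closeUp {t = false} q≡v v∉st bul stk@(open₁ k∉st _ stk₂) seen =
          inj₁ (lockTop q≡v v∉st k∉st stk₂ (open₁ v∉st bul stk) seen)

    Opens-later : ∀ {P os : List C} ws {k R q} → New P ws → Opens P (ws ++ k ∷ R) os → q ∈ os → q ≢ k → q ∈ R
    Opens-later ws new op q∈ q≢k with ∈-++⁻ ws (Opens.pending op q∈)
    ... | inj₁ q∈ws = ⊥-elim (New-∉ new q∈ws (Opens-∈ op q∈))
    ... | inj₂ (here refl) = ⊥-elim (q≢k refl)
    ... | inj₂ (there q∈R) = q∈R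

    -- The conditions are tested in turn: k directly under the top color, only single socks before
    -- it, and v as the color of the next second sock. Bullets are left to `closeUp`.
    buried : ∀ {P p k R} {os st : List C} {t v} ws → New (P ++ [ p ]) ws → (eq : (P ++ [ p ]) ++ ws ++ k ∷ R ≡ s) →
      p ∈ P → reverse (v ∷ os) ⊆ P → v ∉ st → (t ≡ true → ∀ {q os′} → os ≡ q ∷ os′ → Bullet (P ++ [ p ]) q v) →
      Stack (P ++ [ p ]) (ws ++ k ∷ R) t os st → (∀ {q} → q ∈ v ∷ st → q ∈ P ++ [ p ]) →
      Opens (P ++ [ p ]) (ws ++ k ∷ R) (v ∷ os) → k ∈ os → After (ws ++ k ∷ R) (v ∷ st) ⊎ Contains s
    buried {os = u ∷ os} {v = v} ws new eq p∈ before v∉st bul stk seen op (there k∈os) =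
      inj₂ (Deep.threeOpen ws eq p∈ (⊆-trans (reverse⁺ {as = v ∷ u ∷ _ ∷ []} (refl ∷ refl ∷ from∈ k∈os)) before)
        (Opens-later ws new op (there (here refl)) (λ { refl → Opens-unique eq op (v ∷ʳ refl ∷ from∈ k∈os) }))
        (Opens-later ws new op (here refl) (λ { refl → Opens-unique eq op (refl ∷ u ∷ʳ from∈ k∈os) })))
    buried {P} {p} {k} {R} {k ∷ os} {v = v} ws new eq p∈ before v∉st bul stk seen op (here refl)
      with Any.any? (_∈? R) ws |
          Opens-later {os = v ∷ k ∷ os} ws {k} {R} {v} new op (here refl)
          (λ { refl → Opens-unique eq op (refl ∷ refl ∷ minimum os) })
    ... | yes any | v∈R = let w , w∈ws , w∈R = find any in
      inj₂ (Deep.newOpen ws eq p∈ (⊆-trans (reverse⁺ {as = v ∷ k ∷ []} (refl ∷ refl ∷ minimum os)) before)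
        v∈R w∈ws w∈R λ { refl → New-∉ new w∈ws (Opens-∈ op (here refl)) })
    ... | no ¬any | v∈R with split _≟_ (((P ++ [ p ]) ++ ws) ++ [ k ]) R
    ... | inj₁ new₂ = ⊥-elim (New-∉ new₂ v∈R (∈-++⁺ˡ (∈-++⁺ˡ (Opens-∈ op (here refl)))))
    ... | inj₂ (us , q , R′ , refl , new₂ , q∈) with q ≟ v
    ... | yes q≡v = Under.closeUp ws us new new₂ eq p∈ before op v∈R
        (λ r∈ws r∈R → ¬any (lose r∈ws r∈R)) q≡v v∉st bul stk seen
    ... | no q≢v = inj₂ (Under.other ws us new new₂ eq p∈ before op v∈R (λ r∈ws r∈R → ¬any (lose r∈ws r∈R)) q∈ q≢v)

    -- Induction on the remaining input

    sortNew : ∀ {P R : List C} → New P R → Sorts R []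
    sortNew [] = done
    sortNew new@(_ ∷ new′) = put (pop₁ (New-head new) (λ ()) (sortNew new′))

    -- A round starts at the very beginning or right after a second sock; in the latter case its
    -- color is the p from which the obstructions are built.
    next : ∀ {P R os st : List C} → P ++ R ≡ s → St P P R false os st →
      (P ≡ [] ⊎ ∃[ Q ] ∃[ p ] P ≡ Q ++ [ p ] × p ∈ Q × reverse os ⊆ Q) →
      Sorts R st ⊎ After R st ⊎ Contains s
    next {P} {R} {os} eq state prev with split _≟_ P R
    next {P} {R} eq (mkSt [] _ _) prev | inj₁ new = inj₁ (sortNew new)
    next {P} {R} eq (mkSt (open₁ _ _ _) _ op) prev | inj₁ new =
      ⊥-elim (New-∉ new (Opens.pending op (here refl)) (Opens-∈ op (here refl)))
    next eq state prev | inj₂ (ws , k , R′ , refl , new , inj₂ k∈ws) = inj₂ (inj₁ (ahead ws new k∈ws eq state))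
    next eq state (inj₁ refl) | inj₂ (ws , k , R′ , refl , new , inj₁ ())
    next eq (mkSt stk seen op) (inj₂ (Q , p , refl , p∈ , before)) | inj₂ (ws , k , R′ , refl , new , inj₁ k∈P)
      with stk | Opens.complete op k∈P (∈-++⁺ʳ ws (here refl))
    ... | open₁ _ _ _ | here refl = inj₂ (inj₁ (atTop ws new eq (mkSt stk seen op)))
    ... | open₁ v∉st bul stk′ | there k∈os = inj₂ (buried ws new eq p∈ before v∉st bul stk′ seen op k∈os)

    greedy : ∀ n {P R os st : List C} → length R ≤ n → P ++ R ≡ s → St P P R false os st →
      (P ≡ [] ⊎ ∃[ Q ] ∃[ p ] P ≡ Q ++ [ p ] × p ∈ Q × reverse os ⊆ Q) → Sorts R st ⊎ Contains s
    greedy n R≤n eq state prev with next eq state prev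
    ... | inj₁ sorted = inj₁ sorted
    ... | inj₂ (inj₂ cont) = inj₂ cont
    greedy zero R≤n eq state prev | inj₂ (inj₁ (after _ _ _ _ shorter _)) =
        ⊥-elim (ℕ.<-irrefl refl (≤-trans shorter (≤-trans R≤n z≤n)))
    greedy (suc n) R≤n eq state prev | inj₂ (inj₁ (after eq′ last∈ state′ before shorter sorts)) with normalise _≟_ state′
    ... | st′ , state″ , unwind with greedy n (s≤s⁻¹ (≤-trans shorter R≤n)) eq′ state″ (inj₂ (_ , _ , refl , last∈ , before))
    ... | inj₁ sorted = inj₁ (sorts (unwind sorted))
    ... | inj₂ cont = inj₂ cont

    sortable-or-contains : FootSortable s ⊎ Contains s
    sortable-or-contains with greedy (length s) {[]} {s} ≤-refl refl (mkSt [] (λ ()) (opens [] (λ ()) (λ ()))) (inj₁ refl)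
    ... | inj₁ sorted = inj₁ (Sorts⇒FootSortable sorted)
    ... | inj₂ cont = inj₂ cont

-- Listed words are not sortable

-- The stack is emptied from the top down and after everything output so far. Together with
-- `output-input` this locates the sandwiches below.
output-stack : Star _⟶_ ⟨ i , st , o ⟩ ⟨ [] , [] , l ⟩ → us ⊆ o → vs ⊆ st → us ++ vs ⊆ l
output-stack r σ τ = ⊆-trans (++⁺ σ τ) (Star-output r)

output-input : ∀ {p} → Star _⟶_ ⟨ i , st , o ⟩ ⟨ [] , [] , l ⟩ → us ⊆ o → p ∈ i → us ++ [ p ] ⊆ l
output-input r σ p∈ = ⊆-trans (++⁺ σ ⊆-refl) (Star-input r p∈)

Ungrouped : List SporadicColor → Set
Ungrouped w = ¬ Grouped _≡_ w

-- The list m is the output so far, and L contains colors that occur after i.  A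
-- state is abandoned if its output is bound to become ungrouped.
module Search (L : List SporadicColor) (goal : List SporadicColor → Bool) where

  stuck? : (m i st : List SporadicColor) → Dec (Ungrouped (m ++ st) ⊎ Any.Any (λ p → Ungrouped (m ++ [ p ])) (i ++ L))
  stuck? m i st = ¬? (grouped? _≟ₛ_ (m ++ st)) ⊎-dec Any.any? (λ p → ¬? (grouped? _≟ₛ_ (m ++ [ p ]))) (i ++ L)

  mutual
    check : ℕ → (m i st : List SporadicColor) → Bool
    -- Running out of fuel counts as failure, so a successful check is conclusive.
    check zero m i st = false
    -- With the input used up, further pops belong to the rest of the run, and `goal` describes the
    -- stack from which that rest starts.
    check (suc n) m [] st = ⌊ stuck? m [] st ⌋ ∨ goal st
    check (suc n) m (p ∷ i) st = ⌊ stuck? m (p ∷ i) st ⌋ ∨ (check n m i (p ∷ st) ∧ checkPop n m (p ∷ i) st)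

    checkPop : ℕ → (m i st : List SporadicColor) → Bool
    checkPop n m i [] = true
    checkPop n m i (q ∷ st) = check n (m ++ [ q ]) i st

  module _ {C : Set ℓ} (h : SporadicColor → C) (inj : ∀ {p q} → h p ≡ h q → p ≡ q)
    {D : List C} (later : ∀ {p} → p ∈ L → h p ∈ D) {l : List C} (grouped : Grouped _≡_ l) where

    groupedPart : ∀ w → map h w ⊆ l → Grouped _≡_ w
    groupedPart w τ = SandwichFree⇒Grouped _≟ₛ_ w λ υ → inj (Grouped⇒SandwichFree grouped (⊆-trans (Sub.map⁺ h υ) τ))

    not-stuck : ∀ m i st {o} → map h m ⊆ o → Star _⟶_ ⟨ map h i ++ D , map h st , o ⟩ ⟨ [] , [] , l ⟩ →
      ¬ (Ungrouped (m ++ st) ⊎ Any.Any (λ p → Ungrouped (m ++ [ p ])) (i ++ L))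
    not-stuck m i st σ r (inj₁ bad) =
      bad (groupedPart (m ++ st) (subst (_⊆ l) (sym (map-++ h m st)) (output-stack r σ ⊆-refl)))
    not-stuck m i st σ r (inj₂ any) with find any
    ... | p , p∈ , bad = bad
        (groupedPart (m ++ [ p ]) (subst (_⊆ l) (sym (map-++ h m [ p ])) (output-input r σ (remaining (∈-++⁻ i p∈)))))
      where
      remaining : p ∈ i ⊎ p ∈ L → h p ∈ map h i ++ D
      remaining (inj₁ p∈i) = ∈-++⁺ˡ (∈-map⁺ h p∈i)
      remaining (inj₂ p∈L) = ∈-++⁺ʳ (map h i) (later p∈L)

    check-sound : ∀ n m i st {o} → T (check n m i st) → map h m ⊆ o →
      Star _⟶_ ⟨ map h i ++ D , map h st , o ⟩ ⟨ [] , [] , l ⟩ →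
      ∃[ st′ ] ∃[ o′ ] T (goal st′) × Star _⟶_ ⟨ D , map h st′ , o′ ⟩ ⟨ [] , [] , l ⟩
    check-sound (suc n) m [] st ok σ r with Equivalence.to (T-∨ {⌊ stuck? m [] st ⌋}) ok
    ... | inj₁ bad = ⊥-elim (not-stuck m [] st σ r (toWitness bad))
    ... | inj₂ good = st , _ , good , r
    check-sound (suc n) m (p ∷ i) st ok σ r with Equivalence.to (T-∨ {⌊ stuck? m (p ∷ i) st ⌋}) ok
    ... | inj₁ bad = ⊥-elim (not-stuck m (p ∷ i) st σ r (toWitness bad))
    ... | inj₂ good with Equivalence.to (T-∧ {check n m i (p ∷ st)}) good
    check-sound (suc n) m (p ∷ i) [] ok σ (push ◅ r) | inj₂ _ | onPush , _ = check-sound n m i (p ∷ []) onPush σ r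
    check-sound (suc n) m (p ∷ i) (q ∷ st) ok σ (push ◅ r) | inj₂ _ | onPush , _ = check-sound n m i (p ∷ q ∷ st) onPush σ r
    check-sound (suc n) m (p ∷ i) (q ∷ st) ok σ (pop ◅ r) | inj₂ _ | _ , onPop =
      check-sound n (m ++ [ q ]) (p ∷ i) st onPop (subst (_⊆ _) (sym (map-++ h m [ q ])) (++⁺ σ ⊆-refl)) r

unsortable? : List SporadicColor → Bool
-- No sock follows `w`, so every branch has to be abandoned. The sporadic words have at most ten
-- socks and hence at most twenty moves, for which 30 is enough fuel.
unsortable? w = Search.check [] (λ _ → false) 30 [] w []

unsortable?-sound : ∀ w → T (unsortable? w) → ¬ FootSortable w
unsortable?-sound w ok (l , r , g)
  with Search.check-sound [] (λ _ → false) (λ p → p) (λ eq → eq) {[]} (λ ()) g 30 [] w [] ok []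
         (subst (λ i → Star _⟶_ ⟨ i , [] , [] ⟩ _) (sym (trans (++-identityʳ _) (map-id w))) r)
... | _ , _ , () , _

sporadic-unsortable : ∀ j → ¬ FootSortable (lookup sporadic j)
sporadic-unsortable j =
    unsortable?-sound (lookup sporadic j)
    (VecAll.lookup⁺ (from-yes (VecAll.all? (λ w → T? (unsortable? w)) sporadic)) j)

-- Collects the pops before the next push, so that a run can be analyzed letter by letter of its
-- input.
next-push : ∀ {p i} {st o l : List C} → Star _⟶_ ⟨ p ∷ i , st , o ⟩ ⟨ [] , [] , l ⟩ →
  ∃[ popped ] ∃[ st′ ] st ≡ popped ++ st′ × Star _⟶_ ⟨ i , p ∷ st′ , o ++ popped ⟩ ⟨ [] , [] , l ⟩
next-push {st = st} {o} (push ◅ r) = [] , st , refl , subst (λ o → Star _⟶_ ⟨ _ , _ , o ⟩ _) (sym (++-identityʳ o)) r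
next-push {o = o} (pop {s = q} ◅ r) with next-push r
... | popped , st′ , refl , r′ = q ∷ popped , st′ , refl ,
    subst (λ o → Star _⟶_ ⟨ _ , _ , o ⟩ _) (++-assoc o [ q ] popped) r′

split-head : ∀ {p} {l v : List C} u → p ∷ l ⊆ u ++ v → p ∈ u ⊎ p ∷ l ⊆ v
split-head [] τ = inj₂ τ
split-head (_ ∷ u) (refl ∷ τ) = inj₁ (here refl)
split-head (_ ∷ u) (_ ∷ʳ τ) with split-head u τ
... | inj₁ p∈u = inj₁ (there p∈u)
... | inj₂ υ = inj₂ υ

split-next : ∀ {p q} {l v : List C} u → p ∷ q ∷ l ⊆ u ++ v → p ∷ q ∷ [] ⊆ u ⊎ (p ∈ u × q ∷ l ⊆ v) ⊎ p ∷ q ∷ l ⊆ v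
split-next [] τ = inj₂ (inj₂ τ)
split-next (_ ∷ u) (refl ∷ τ) with split-head u τ
... | inj₁ q∈u = inj₁ (refl ∷ from∈ q∈u)
... | inj₂ υ = inj₂ (inj₁ (here refl , υ))
split-next (_ ∷ u) (_ ∷ʳ τ) with split-next u τ
... | inj₁ pq = inj₁ (_ ∷ʳ pq)
... | inj₂ (inj₁ (p∈u , υ)) = inj₂ (inj₁ (there p∈u , υ))
... | inj₂ (inj₂ υ) = inj₂ (inj₂ υ)

α-inj : ∀ {j k} → α j ≡ α k → j ≡ k
α-inj refl = refl

-- Either αₖ₊₁ is output before its second sock arrives, and then αₖ takes its place
-- above q; or αₖ is, and then αₖ₋₁ does.  In the end q separates the socks of α₀.
mutual
  descent-stuck : ∀ k {q l} → (∀ {j} → q ≢ α j) → SandwichFree l → ∀ {st o} → α (suc k) ∷ q ∷ α 0 ∷ [] ⊆ st →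
    ¬ Star _⟶_ ⟨ descent (suc (suc k)) , st , o ⟩ ⟨ [] , [] , l ⟩
  descent-stuck k {q} q≢ sf {o = o} τ r with next-push r
  ... | u , st₁ , refl , r₁ with split-next u τ | next-push r₁
  -- Both αₖ₊₁ and q have left, so q separates the socks of αₖ₊₁.
  ... | inj₁ σ | _ = q≢ (sym (sf (output-input r₁ (++⁺ˡ o σ) (here refl))))
  ... | inj₂ (inj₁ (σ , υ)) | [] , _ , refl , r₂ = high-popped k q≢ sf υ r₂
  -- αₖ leaves after the first αₖ₊₁ and before the second one arrives.
  ... | inj₂ (inj₁ (σ , υ)) | _ ∷ v , _ , refl , r₂ =
    ℕ.1+n≢n (α-inj (sf (output-stack {vs = α (suc k) ∷ []} r₂ (++⁺ (++⁺ˡ o (from∈ σ)) (refl ∷ minimum v))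
        (refl ∷ minimum _))))
  -- αₖ lies on the stack between the two socks of αₖ₊₁.
  ... | inj₂ (inj₂ υ) | [] , _ , refl , r₂ =
    ℕ.1+n≢n (α-inj (sf (output-stack r₂ (minimum _) (refl ∷ refl ∷ ⊆-trans (refl ∷ minimum _) υ))))
  ... | inj₂ (inj₂ υ) | _ ∷ v , _ , eq , r₂ with ∷-injectiveˡ eq | ∷-injectiveʳ eq
  ... | refl | refl = low-popped k q≢ sf v υ (++⁺ˡ (o ++ u) ⊆-refl) r₂

  high-popped : ∀ k {q l} → (∀ {j} → q ≢ α j) → SandwichFree l → ∀ {p st o} → q ∷ α 0 ∷ [] ⊆ st →
    ¬ Star _⟶_ ⟨ descent (suc k) , p ∷ α k ∷ st , o ⟩ ⟨ [] , [] , l ⟩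
  high-popped zero q≢ sf υ r = q≢ (sym (sf (output-stack r (minimum _) (_ ∷ʳ refl ∷ υ))))
  high-popped (suc k) q≢ sf υ r = descent-stuck k q≢ sf (_ ∷ʳ refl ∷ υ) r

  low-popped : ∀ k {q l} → (∀ {j} → q ≢ α j) → SandwichFree l → ∀ v {st o} → α (suc k) ∷ q ∷ α 0 ∷ [] ⊆ v ++ st →
    α k ∷ v ⊆ o → ¬ Star _⟶_ ⟨ descent (suc k) , α (suc k) ∷ st , o ⟩ ⟨ [] , [] , l ⟩
  low-popped zero q≢ sf v τ out r =
    -- One sock of α₀ has been output, and q leaves between it and the other one.
    q≢ (sym (sf (⊆-trans (refl ∷ ⊆-trans (_ ∷ʳ ⊆-refl) τ) (output-stack r out (_ ∷ʳ ⊆-refl)))))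
  low-popped (suc k) q≢ sf v τ out r with split-head v τ
  ... | inj₁ σ = ℕ.1+n≢n (sym (α-inj (sf (output-input r (⊆-trans (refl ∷ from∈ σ) out) (there (here refl))))))
  ... | inj₂ υ with next-push r
  ... | w , st₃ , eq , r₃ with split-head w (subst (_ ⊆_) eq (_ ∷ʳ υ)) | next-push r₃
  ... | _ | _ ∷ w′ , _ , refl , r₄ =
    ℕ.1+n≢n (α-inj (sf (output-stack {vs = α (suc k) ∷ []} r₄
        (++⁺ (++⁺ʳ w (⊆-trans (refl ∷ minimum v) out)) (refl ∷ minimum w′)) (refl ∷ minimum _))))
  ... | inj₁ σ′ | [] , _ , refl , r₄ =
    ℕ.1+n≢n (sym (α-inj (sf
        (output-stack {vs = α (suc k) ∷ []} r₄ (++⁺ʳ [] (++⁺ (⊆-trans (refl ∷ minimum v) out) (from∈ σ′)))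
        (refl ∷ minimum _)))))
  -- Nothing leaves between αₖ and αₖ₊₁, and αₖ lies above q.
  ... | inj₂ υ′ | [] , _ , refl , r₄ = high-popped k q≢ sf (∷ˡ⁻ υ′) r₄

palette-inj : ∀ {j k} → suc j ≢ suc k → ∀ {p q} →
  palette (α 0) x y z (α (suc j)) (α (suc k)) p ≡ palette (α 0) x y z (α (suc j)) (α (suc k)) q → p ≡ q
palette-inj j≢k {a} {a} eq = refl
palette-inj j≢k {b} {b} eq = refl
palette-inj j≢k {c} {c} eq = refl
palette-inj j≢k {d} {d} eq = refl
palette-inj j≢k {e} {e} eq = refl
palette-inj j≢k {f} {f} eq = refl
palette-inj j≢k {e} {f} eq = ⊥-elim (j≢k (α-inj eq))
palette-inj j≢k {f} {e} eq = ⊥-elim (j≢k (sym (α-inj eq)))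

above : (p q r : SporadicColor) → List SporadicColor → Bool
above p q r st = ⌊ (p ∷ q ∷ r ∷ []) ⊆? st ⌋

-- A finite search covers the word up to the descent, for B, B′ and C including the pair αₙ₋₂αₙ₋₁.
-- It leaves only stacks with αₙ₋₁, or αₙ₋₂ respectively, above y above α₀ (x instead of y for C),
-- where `descent-stuck` applies.
family-unsortable : ∀ F k → least F ≤ k → ¬ FootSortable (family F (suc (suc k)))
family-unsortable fA k _ (l , r , g) with Search.check-sound (a ∷ e ∷ []) (above e c a)
    (palette (α 0) x y z (α (suc k)) (α (suc (suc k)))) (palette-inj (λ eq → ℕ.1+n≢n (sym eq)))
    (λ { (here refl) → α∈descent k z≤n ; (there (here refl)) → there (here refl) })
    g 20 [] (b ∷ a ∷ c ∷ e ∷ b ∷ []) [] _ [] r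
... | st , o , good , r′ =
    descent-stuck k (λ ()) (Grouped⇒SandwichFree g)
    (Sub.map⁺ (palette (α 0) x y z (α (suc k)) (α (suc (suc k)))) (toWitness good)) r′
family-unsortable fB (suc k) _ (l , r , g) with Search.check-sound (a ∷ f ∷ []) (above f c a)
    (palette (α 0) x y z (α (suc (suc k))) (α (suc k))) (palette-inj ℕ.1+n≢n)
    (λ { (here refl) → α∈descent k z≤n ; (there (here refl)) → there (here refl) })
    g 20 [] (a ∷ b ∷ c ∷ e ∷ b ∷ c ∷ f ∷ e ∷ []) [] _ [] r
... | st , o , good , r′ =
    descent-stuck k (λ ()) (Grouped⇒SandwichFree g)
    (Sub.map⁺ (palette (α 0) x y z (α (suc (suc k))) (α (suc k))) (toWitness good)) r′
family-unsortable fB′ (suc k) _ (l , r , g) with Search.check-sound (a ∷ f ∷ []) (above f c a)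
    (palette (α 0) x y z (α (suc (suc k))) (α (suc k))) (palette-inj ℕ.1+n≢n)
    (λ { (here refl) → α∈descent k z≤n ; (there (here refl)) → there (here refl) })
    g 20 [] (a ∷ c ∷ b ∷ e ∷ b ∷ c ∷ f ∷ e ∷ []) [] _ [] r
... | st , o , good , r′ =
    descent-stuck k (λ ()) (Grouped⇒SandwichFree g)
    (Sub.map⁺ (palette (α 0) x y z (α (suc (suc k))) (α (suc k))) (toWitness good)) r′
family-unsortable fC (suc k) _ (l , r , g) with Search.check-sound (a ∷ f ∷ []) (above f b a)
    (palette (α 0) x y z (α (suc (suc k))) (α (suc k))) (palette-inj ℕ.1+n≢n)
    (λ { (here refl) → α∈descent k z≤n ; (there (here refl)) → there (here refl) })
    g 20 [] (a ∷ b ∷ e ∷ c ∷ d ∷ c ∷ b ∷ f ∷ e ∷ []) [] _ [] r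
... | st , o , good , r′ =
    descent-stuck k (λ ()) (Grouped⇒SandwichFree g)
    (Sub.map⁺ (palette (α 0) x y z (α (suc (suc k))) (α (suc k))) (toWitness good)) r′

open DecMembership _≟ₛ_ using (_∈?_)


-- No color occurs three times in a listed word

module _ {C : Set ℓ} (_≟_ : DecidableEquality C) where

  2-Bounded⇒NoTriple : ∀ {s} → 2-Bounded _≟_ s → NoTriple s
  2-Bounded⇒NoTriple {s} bounded {p} τ =
    ℕ.<-irrefl refl (≤-trans (subst (λ l → length l ≤ length (filter (p ≟_) s)) (filter-all (p ≟_) (refl ∷ refl ∷ refl ∷ []))
      (length-mono-≤ (Sub.filter⁺ (p ≟_) (p ≟_) (λ { refl eq → eq }) τ))) (bounded p))

  NoTriple⇒2-Bounded : ∀ {s} → NoTriple s → 2-Bounded _≟_ s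
  NoTriple⇒2-Bounded {s} nt p = short (All.all-filter (p ≟_) s) (NoTriple-⊆ (filter-⊆ (p ≟_) s) nt)
    where
    short : ∀ {l} → All (p ≡_) l → NoTriple l → length l ≤ 2
    short [] _ = z≤n
    short (_ ∷ []) _ = s≤s z≤n
    short (_ ∷ _ ∷ []) _ = ≤-refl
    short (refl ∷ refl ∷ refl ∷ _) nt = ⊥-elim (nt (refl ∷ refl ∷ refl ∷ minimum _))

⊆-map⁻ : (h : B → C) (w : List B) {l : List C} → l ⊆ map h w → ∃[ l′ ] l′ ⊆ w × l ≡ map h l′
⊆-map⁻ h [] [] = [] , [] , refl
⊆-map⁻ h (p ∷ w) (_ ∷ʳ τ) with ⊆-map⁻ h w τ
... | l′ , υ , eq = l′ , p ∷ʳ υ , eq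
⊆-map⁻ h (p ∷ w) (refl ∷ τ) with ⊆-map⁻ h w τ
... | l′ , υ , eq = p ∷ l′ , refl ∷ υ , cong (h p ∷_) eq

⊆-map-injective : (h : B → C) → (∀ {p q} → h p ≡ h q → p ≡ q) → ∀ {l w} → map h l ⊆ map h w → l ⊆ w
⊆-map-injective h inj {w = w} τ with ⊆-map⁻ h w τ
... | l′ , υ , eq = subst (_⊆ w) (sym (map-injective inj eq)) υ

NoTriple-map : (h : B → C) {w : List B} → InjectiveOn h w → NoTriple w → NoTriple (map h w)
NoTriple-map h {w} inj nt τ with ⊆-map⁻ h w τ
... | p ∷ q ∷ r ∷ [] , υ , eq
  with inj (to∈ υ) (to∈ (∷ˡ⁻ υ)) (trans (sym (∷-injectiveˡ eq)) (∷-injectiveˡ (∷-injectiveʳ eq)))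
     | inj (to∈ υ) (to∈ (∷ˡ⁻ (∷ˡ⁻ υ))) (trans (sym (∷-injectiveˡ eq)) (∷-injectiveˡ (∷-injectiveʳ (∷-injectiveʳ eq))))
... | refl | refl = nt υ

sporadic-NoTriple : ∀ j → NoTriple (lookup sporadic j)
sporadic-NoTriple j τ = All.lookup (VecAll.lookup⁺ checked j) (to∈ τ) τ
  where
  checked : VecAll.All (λ w → All (λ p → ¬ p ∷ p ∷ p ∷ [] ⊆ w) w) sporadic
  checked = from-yes (VecAll.all? (λ w → All.all? (λ p → ¬? (p ∷ p ∷ p ∷ [] ⊆? w)) w) sporadic)

α∉descent : ∀ {j} n → n ≤ j → α j ∉ descent n
α∉descent n n≤j α∈ with ∈-descent n α∈
... | j , j<n , refl = ℕ.<-irrefl refl (≤-trans j<n n≤j)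

descent-single-last : ∀ k → ¬ α (suc k) ∷ α (suc k) ∷ [] ⊆ descent (suc (suc k))
descent-single-last k (_ ∷ʳ refl ∷ τ) = α∉descent (suc k) ≤-refl (to∈ τ)
descent-single-last k (_ ∷ʳ _ ∷ʳ τ) = α∉descent (suc k) ≤-refl (to∈ τ)

descent-single-zero : ∀ k → ¬ α 0 ∷ α 0 ∷ [] ⊆ descent (suc (suc k))
descent-single-zero zero (refl ∷ _ ∷ʳ ())
descent-single-zero zero (_ ∷ʳ _ ∷ʳ ())
descent-single-zero (suc k) (_ ∷ʳ _ ∷ʳ τ) = descent-single-zero k τ

descent-NoTriple : ∀ n → NoTriple (descent n)
descent-NoTriple (suc (suc zero)) (refl ∷ _ ∷ʳ ())
descent-NoTriple (suc (suc (suc k))) (refl ∷ _ ∷ʳ τ) = descent-single-last k τ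
descent-NoTriple (suc (suc k)) (_ ∷ʳ refl ∷ τ) = α∉descent (suc k) ≤-refl (to∈ τ)
descent-NoTriple (suc (suc k)) (_ ∷ʳ _ ∷ʳ τ) = descent-NoTriple (suc k) τ

⊆-++-left : ∀ {l} (w : List C) {D} → l ⊆ w ++ D → (∀ {p} → p ∈ l → p ∉ D) → l ⊆ w
⊆-++-left {l = []} w τ ∉D = minimum w
⊆-++-left {l = p ∷ l} [] τ ∉D = ⊥-elim (∉D (here refl) (to∈ τ))
⊆-++-left {l = p ∷ l} (_ ∷ w) (_ ∷ʳ τ) ∉D = _ ∷ʳ ⊆-++-left w τ ∉D
⊆-++-left {l = p ∷ l} (_ ∷ w) (refl ∷ τ) ∉D = refl ∷ ⊆-++-left w τ (∉D ∘ there)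

NoTriple-++ : (w : List C) {D : List C} → NoTriple D →
  (∀ {p} → p ∈ w → (p ∉ D × ¬ p ∷ p ∷ p ∷ [] ⊆ w) ⊎ (¬ p ∷ p ∷ [] ⊆ D × ¬ p ∷ p ∷ [] ⊆ w)) → NoTriple (w ++ D)
NoTriple-++ w nt few τ with split-head w τ
... | inj₂ υ = nt υ
... | inj₁ p∈w with few p∈w
... | inj₁ (p∉D , ¬ppp) =
    ¬ppp (⊆-++-left w τ λ { (here refl) → p∉D ; (there (here refl)) → p∉D ; (there (there (here refl))) → p∉D })
... | inj₂ (¬pp-D , ¬pp-w) with split-next w τ
... | inj₁ pp = ¬pp-w pp
... | inj₂ (inj₁ (_ , pp)) = ¬pp-D pp
... | inj₂ (inj₂ ppp) = nt ppp

-- The colors x, y, z are absent from the descent, and α₀ and αₙ₋₁ occur in it at most once. What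
-- concerns the start is decided on concrete letters, with `a` for α₀ and `e` for αₙ₋₁.
family-NoTriple : ∀ F k → NoTriple (family F (suc (suc k)))
family-NoTriple F k = subst (λ w → NoTriple (w ++ descent (suc (suc k)))) (start-map F)
    (NoTriple-++ (map h w) (descent-NoTriple (suc (suc k))) few)
  where
  h = palette (α 0) x y z (α (suc k)) (α (suc (suc k)))
  h-inj : ∀ {p q} → h p ≡ h q → p ≡ q
  h-inj = palette-inj (λ eq → ℕ.1+n≢n (sym eq))
  w = start F b c d a e
  start-map : ∀ F → map h (start F b c d a e) ≡ start F x y z (α 0) (α (suc k))
  start-map fA = refl
  start-map fB = refl
  start-map fB′ = refl
  start-map fC = refl
  Few : List SporadicColor → Set
  Few w = All (λ p → (p ∈ b ∷ c ∷ d ∷ [] × ¬ p ∷ p ∷ p ∷ [] ⊆ w) ⊎ (p ∈ a ∷ e ∷ [] × ¬ p ∷ p ∷ [] ⊆ w)) w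
  few? : ∀ w → Dec (Few w)
  few? w = All.all? (λ p →
      ((p ∈? b ∷ c ∷ d ∷ []) ×-dec ¬? (p ∷ p ∷ p ∷ [] ⊆? w)) ⊎-dec ((p ∈? a ∷ e ∷ []) ×-dec ¬? (p ∷ p ∷ [] ⊆? w))) w
  checked : ∀ F → Few (start F b c d a e)
  checked fA = from-yes (few? (start fA b c d a e))
  checked fB = from-yes (few? (start fB b c d a e))
  checked fB′ = from-yes (few? (start fB′ b c d a e))
  checked fC = from-yes (few? (start fC b c d a e))
  D = descent (suc (suc k))
  absent : ∀ {p} → p ∈ b ∷ c ∷ d ∷ [] → h p ∉ D
  absent p∈ q∈ with ∈-descent (suc (suc k)) q∈
  absent (here refl) _ | _ , _ , ()
  absent (there (here refl)) _ | _ , _ , ()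
  absent (there (there (here refl))) _ | _ , _ , ()
  single : ∀ {p} → p ∈ a ∷ e ∷ [] → ¬ h p ∷ h p ∷ [] ⊆ D
  single (here refl) = descent-single-zero k
  single (there (here refl)) = descent-single-last k
  few : ∀ {p} → p ∈ map h w → (p ∉ D × ¬ p ∷ p ∷ p ∷ [] ⊆ map h w) ⊎ (¬ p ∷ p ∷ [] ⊆ D × ¬ p ∷ p ∷ [] ⊆ map h w)
  few p∈ with ∈-map⁻ h p∈
  ... | q , q∈ , refl with All.lookup (checked F) q∈
  ... | inj₁ (q∈bcd , ¬qqq) = inj₁ (absent q∈bcd , ¬qqq ∘ ⊆-map-injective h h-inj)
  ... | inj₂ (q∈ae , ¬qq) = inj₂ (single q∈ae , ¬qq ∘ ⊆-map-injective h h-inj)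

-- Minimality of the sporadic words

Completion : (i st o : List SporadicColor) → Set
Completion i st o = ∃[ l ] Star _⟶_ ⟨ i , st , o ⟩ ⟨ [] , [] , l ⟩ × Grouped _≡_ l

-- The search returns a run together with the proof that its output is grouped. Pruning and fuel can
-- only lose solutions, so success by evaluation is a proof.
solve : ℕ → (i st o : List SporadicColor) → Maybe (Completion i st o)
solve zero i st o = nothing
solve (suc n) i st o with Search.stuck? [] (λ _ → true) o i st
... | yes _ = nothing
... | no _ = finish i st <∣> onPop i st <∣> onPush i st
  where
  finish : ∀ i st → Maybe (Completion i st o)
  finish [] [] with grouped? _≟ₛ_ o
  ... | yes g = just (o , ε , g)
  ... | no _ = nothing
  finish _ _ = nothing
  onPop : ∀ i st → Maybe (Completion i st o)
  onPop i [] = nothing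
  onPop i (p ∷ st) with solve n i st (o ++ [ p ])
  ... | just (l , r , g) = just (l , pop ◅ r , g)
  ... | nothing = nothing
  onPush : ∀ i st → Maybe (Completion i st o)
  onPush [] st = nothing
  onPush (p ∷ i) st with solve n i (p ∷ st) o
  ... | just (l , r , g) = just (l , push ◅ r , g)
  ... | nothing = nothing

is-just⇒ : ∀ {A : Set} (m : Maybe A) → T (is-just m) → A
is-just⇒ (just v) _ = v

sporadic-minimal : ∀ j i → FootSortable (removeAt (lookup sporadic j) i)
sporadic-minimal j i = is-just⇒ (solve 30 (removeAt (lookup sporadic j) i) [] []) (VecAll.lookup⁺ checked j i)
  where
  checked : VecAll.All (λ w → ∀ i → T (is-just (solve 30 (removeAt w i) [] []))) sporadic
  checked = from-yes (VecAll.all? (λ w → Fin.all? (λ i → T? (is-just (solve 30 (removeAt w i) [] [])))) sporadic)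

-- Minimality of the family words

infixr 5 _∷∉_
_∷∉_ : ∀ {p q : C} {l} → p ≢ q → p ∉ l → p ∉ q ∷ l
(p≢q ∷∉ p∉l) (here p≡q) = p≢q p≡q
(p≢q ∷∉ p∉l) (there p∈l) = p∉l p∈l

[]∉ : ∀ {p : C} → p ∉ []
[]∉ ()

NotGreek : FamilyColor → Set
NotGreek p = ∀ {j} → p ≢ α j

∉descent : ∀ {p} n → NotGreek p → p ∉ descent n
∉descent n p≢ p∈ with ∈-descent n p∈
... | j , _ , p≡ = p≢ p≡

∈-removeAt⁻ : ∀ {p : C} l i → p ∈ removeAt l i → p ∈ l
∈-removeAt⁻ (_ ∷ l) zero p∈ = there p∈
∈-removeAt⁻ (_ ∷ l) (suc i) (here eq) = here eq
∈-removeAt⁻ (_ ∷ l) (suc i) (there p∈) = there (∈-removeAt⁻ l i p∈)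

αs≢α : ∀ {k} → α (suc k) ≢ α k
αs≢α eq = ℕ.1+n≢n (α-inj eq)

last∉ : ∀ k → α (suc k) ∉ descent (suc k)
last∉ k = α∉descent (suc k) ≤-refl

-- Each pair αₖαₖ₊₁ is read by locking the top color αₖ₊₁, which leaves αₖ in its place.
descend : ∀ k {st} → (∀ {j} → α (suc j) ∉ st) → Sorts (α 0 ∷ α 1 ∷ []) (α 1 ∷ st) →
    Sorts (descent (suc (suc k))) (α (suc k) ∷ st)
descend zero α∉ s = s
descend (suc k) α∉ s = lock {us = α (suc k) ∷ []} (last∉ (suc k)) (αs≢α ∷∉ []∉) α∉ (descend k α∉ s)

descend-onto-α₀ : ∀ k → Sorts (descent (suc (suc k))) (α (suc k) ∷ α 0 ∷ [])
descend-onto-α₀ k = descend k ((λ ()) ∷∉ []∉)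
  (lock {us = α 0 ∷ []} []∉ ((λ ()) ∷∉ []∉) ((λ ()) ∷∉ []∉) (pop₂ []∉ []∉ done))

descend-without-α₀ : ∀ k {st} → (∀ {j} → α j ∉ st) → Sorts [] st → Sorts (descent (suc (suc k))) (α (suc k) ∷ st)
descend-without-α₀ k α∉ s = descend k α∉
  (put (pop₁ ((λ ()) ∷∉ []∉) ((λ ()) ∷∉ α∉) (put (pop₂ []∉ α∉ s))))

descend-without-last : ∀ k → Sorts (descent (suc (suc k))) (α 0 ∷ [])
descend-without-last zero = put (pop₂ ((λ ()) ∷∉ []∉) []∉ (put (pop₁ []∉ []∉ done)))
descend-without-last (suc k) = put (put (pop₁ (last∉ (suc k)) (αs≢α ∷∉ (λ ()) ∷∉ []∉) (descend-onto-α₀ k)))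

-- `mid` is the stack below αₖ₊₁: α₀ under a bullet that can be output once αₖ₊₁ is out of the way.
module _ (mid : List FamilyColor) (α∉mid : ∀ {j} → α (suc j) ∉ mid)
  (unwind : ∀ {i} → (∀ {p} → p ∈ i → ∃[ j ] p ≡ α j) → Sorts i (α 0 ∷ []) → Sorts i mid) where

  greek : ∀ n {p} → p ∈ descent n → ∃[ j ] p ≡ α j
  greek n p∈ with ∈-descent n p∈
  ... | j , _ , eq = j , eq

  -- At the pair that misses a sock, the top color is complete without a lock. This sets the bullet
  -- free, and α₀ becomes accessible.
  descend-removed : ∀ k i → Sorts (removeAt (descent (suc (suc k))) i) (α (suc k) ∷ mid)
  descend-removed k zero = put (pop₂ (last∉ k) α∉mid (unwind (greek (suc k)) (rest k)))
    where
    rest : ∀ k → Sorts (descent (suc k)) (α 0 ∷ [])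
    rest zero = pop₁ []∉ []∉ done
    rest (suc k) = descend-without-last k
  descend-removed k (suc zero) = pop₁ (αs≢α ∷∉ last∉ k) α∉mid
    (unwind (λ { (here eq) → k , eq ; (there p∈) → greek (suc k) p∈ }) (rest k))
    where
    rest : ∀ k → Sorts (α k ∷ descent (suc k)) (α 0 ∷ [])
    rest zero = put (pop₂ []∉ []∉ done)
    rest (suc k) = put (descend-onto-α₀ k)
  descend-removed (suc k) (suc (suc i)) =
    lock {us = α (suc k) ∷ []} (last∉ (suc k) ∘ ∈-removeAt⁻ (descent (suc (suc k))) i) (αs≢α ∷∉ []∉) α∉mid
        (descend-removed k i)

module _ (q : FamilyColor) (q≢ : NotGreek q) where

  q∉ : ∀ {n} → q ∉ descent n
  q∉ {n} = ∉descent n q≢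

  α≢q : ∀ {j} → α j ≢ q
  α≢q eq = q≢ (sym eq)

  q∉greek : ∀ {i} → (∀ {p} → p ∈ i → ∃[ j ] p ≡ α j) → q ∉ i
  q∉greek greek q∈ with greek q∈
  ... | j , eq = q≢ eq

  descend-removed₁ : ∀ k i → Sorts (removeAt (descent (suc (suc k))) i) (α (suc k) ∷ q ∷ α 0 ∷ [])
  descend-removed₁ = descend-removed (q ∷ α 0 ∷ []) (α≢q ∷∉ (λ ()) ∷∉ []∉)
    (λ greek → pop₁ (q∉greek greek) (q≢ ∷∉ []∉))

  -- In B, B′ and C the second sock of q directly precedes the descent. It joins its partner when
  -- αₙ₋₁ has left the stack.
  descend-removed₂ : ∀ k i → Sorts (q ∷ removeAt (descent (suc (suc (suc k)))) i) (α (suc (suc k)) ∷ q ∷ α 0 ∷ [])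
  descend-removed₂ k zero = lock {us = q ∷ []} (last∉ (suc k)) (α≢q ∷∉ []∉) (α≢q ∷∉ (λ ()) ∷∉ []∉)
    (pop₂ q∉ (q≢ ∷∉ []∉) (descend-without-last k))
  descend-removed₂ k (suc zero) = pop₁ (α≢q ∷∉ αs≢α ∷∉ last∉ (suc k)) (α≢q ∷∉ (λ ()) ∷∉ []∉)
    (put (pop₂ (q≢ ∷∉ q∉) (q≢ ∷∉ []∉) (put (descend-onto-α₀ k))))
  descend-removed₂ k (suc (suc i)) = lock {us = q ∷ α (suc k) ∷ []} (last∉ (suc k) ∘ ∈-removeAt⁻ (descent (suc (suc k))) i)
    (α≢q ∷∉ αs≢α ∷∉ []∉) (α≢q ∷∉ (λ ()) ∷∉ []∉)
    (descend-removed (q ∷ q ∷ α 0 ∷ []) (α≢q ∷∉ α≢q ∷∉ (λ ()) ∷∉ []∉)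
      (λ greek → pop₂ (q∉greek greek) (q≢ ∷∉ []∉)) k i)

  descend-removed₃ : ∀ k → Sorts (q ∷ descent (suc (suc (suc k)))) (α (suc (suc k)) ∷ q ∷ [])
  descend-removed₃ k = lock {us = q ∷ α (suc k) ∷ []} (last∉ (suc k)) (α≢q ∷∉ αs≢α ∷∉ []∉) (α≢q ∷∉ []∉)
    (descend-without-α₀ k (α≢q ∷∉ α≢q ∷∉ []∉) (pop₂ []∉ []∉ done))

xy : x ≢ y
xy ()
yx : y ≢ x
yx ()
xα : ∀ {j} → x ≢ α j
xα ()
yα : ∀ {j} → y ≢ α j
yα ()
zα : ∀ {j} → z ≢ α j
zα ()

-- Each position gets an explicit run. A missing sock of the descent is met by following the greedy
-- strategy up to the gap; a missing sock of the start removes the bullet y, αₙ₋₁ or α₀, or the need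
-- to lock x.
familyA-minimal : ∀ k (i : Fin (length (family fA (suc (suc k))))) → Sorts (removeAt (family fA (suc (suc k))) i) []
familyA-minimal k = cases
  where
  n = suc (suc k)
  x∉ = ∉descent n xα
  y∉ = ∉descent n yα
  onto = descend-onto-α₀ k
  cases : (i : Fin (length (family fA n))) → Sorts (removeAt (family fA n) i) []
  cases zero = put (put (pop₁ (yα ∷∉ yx ∷∉ y∉) (yα ∷∉ []∉) (put (put (pop₁ x∉ (xα ∷∉ xα ∷∉ []∉) onto)))))
  cases (suc zero) = put (lock {us = y ∷ α (suc k) ∷ []} x∉ (xy ∷∉ xα ∷∉ []∉) []∉
    (descend-without-α₀ k ((λ ()) ∷∉ []∉) (pop₁ []∉ []∉ done)))
  cases (suc (suc zero)) = put (lock {us = α 0 ∷ α (suc k) ∷ []} x∉ (xα ∷∉ xα ∷∉ []∉) []∉ onto)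
  cases (suc (suc (suc zero))) = put (lock {us = α 0 ∷ y ∷ []} x∉ (xα ∷∉ xy ∷∉ []∉) []∉
    (pop₁ y∉ (yα ∷∉ []∉) (descend-without-last k)))
  cases (suc (suc (suc (suc zero)))) = put (pop₁ (xα ∷∉ xy ∷∉ xα ∷∉ x∉) []∉
    (put (put (pop₁ (yα ∷∉ y∉) (yα ∷∉ []∉) (put onto)))))
  cases (suc (suc (suc (suc (suc i))))) = put (lock {us = α 0 ∷ y ∷ α (suc k) ∷ []} (x∉ ∘ ∈-removeAt⁻ (descent n) i)
    (xα ∷∉ xy ∷∉ xα ∷∉ []∉) []∉ (descend-removed₁ y yα k i))

module _ (k : ℕ) where

  private
    n : ℕ
    n = suc (suc (suc k))
    t : FamilyColor
    t = α (suc (suc k))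
    x∉ : x ∉ descent n
    x∉ = ∉descent n xα
    y∉ : y ∉ descent n
    y∉ = ∉descent n yα
    z∉ : z ∉ descent n
    z∉ = ∉descent n zα
    -- Unless the missing sock is α₀ or belongs to the descent, the start can be processed so that
    -- the stack is αₙ₋₁ over α₀, or α₀ alone if αₙ₋₁ is missing.
    onto : Sorts (descent n) (t ∷ α 0 ∷ [])
    onto = descend-onto-α₀ (suc k)
    bare : Sorts (descent n) (α 0 ∷ [])
    bare = descend-without-last (suc k)

  familyB-minimal : (i : Fin (length (family fB n))) → Sorts (removeAt (family fB n) i) []
  familyB-minimal zero = put (lock {us = y ∷ t ∷ []} (xy ∷∉ x∉) (xy ∷∉ xα ∷∉ []∉) []∉ (descend-removed₃ y yα k))
  familyB-minimal (suc zero) = put (put (lock {us = t ∷ x ∷ []} y∉ (yα ∷∉ yx ∷∉ []∉) (yα ∷∉ []∉)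
    (pop₁ x∉ (xα ∷∉ xα ∷∉ []∉) onto)))
  familyB-minimal (suc (suc zero)) = put (put (lock {us = t ∷ []} (xy ∷∉ x∉) (xα ∷∉ []∉) (xα ∷∉ []∉)
    (put (pop₁ y∉ (yα ∷∉ yα ∷∉ []∉) onto))))
  familyB-minimal (suc (suc (suc zero))) = put (put (lock {us = y ∷ []} (xy ∷∉ x∉) (xy ∷∉ []∉) (xα ∷∉ []∉)
    (put (pop₂ y∉ (yα ∷∉ []∉) bare))))
  familyB-minimal (suc (suc (suc (suc zero)))) = put (put (pop₁ (xy ∷∉ xα ∷∉ xy ∷∉ x∉) (xα ∷∉ []∉)
    (put (lock {us = t ∷ []} y∉ (yα ∷∉ []∉) (yα ∷∉ []∉) onto))))
  familyB-minimal (suc (suc (suc (suc (suc zero))))) = put (put (put (pop₁ (yα ∷∉ yx ∷∉ y∉) (yx ∷∉ yα ∷∉ []∉)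
    (lock {us = t ∷ []} x∉ (xα ∷∉ []∉) (xα ∷∉ []∉) onto))))
  familyB-minimal (suc (suc (suc (suc (suc (suc i)))))) =
    put (put (lock {us = y ∷ t ∷ []} (xy ∷∉ (x∉ ∘ ∈-removeAt⁻ (descent n) i)) (xy ∷∉ xα ∷∉ []∉) (xα ∷∉ []∉)
      (descend-removed₂ y yα k i)))

  familyB′-minimal : (i : Fin (length (family fB′ n))) → Sorts (removeAt (family fB′ n) i) []
  familyB′-minimal zero = put (put (lock {us = t ∷ []} (xy ∷∉ x∉) (xα ∷∉ []∉) (xy ∷∉ []∉) (descend-removed₃ y yα k)))
  familyB′-minimal (suc zero) = put (put (lock {us = t ∷ []} (xy ∷∉ x∉) (xα ∷∉ []∉) (xα ∷∉ []∉)
    (put (pop₁ y∉ (yα ∷∉ yα ∷∉ []∉) onto))))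
  familyB′-minimal (suc (suc zero)) = put (put (lock {us = t ∷ x ∷ []} y∉ (yα ∷∉ yx ∷∉ []∉) (yα ∷∉ []∉)
    (pop₁ x∉ (xα ∷∉ xα ∷∉ []∉) onto)))
  familyB′-minimal (suc (suc (suc zero))) = put (put (put (put (pop₂ (xy ∷∉ x∉) (xy ∷∉ xα ∷∉ []∉)
    (put (pop₂ y∉ (yα ∷∉ []∉) bare))))))
  familyB′-minimal (suc (suc (suc (suc zero)))) = put (put (put (pop₁ (xα ∷∉ xy ∷∉ x∉) (xy ∷∉ xα ∷∉ []∉)
    (lock {us = t ∷ []} y∉ (yα ∷∉ []∉) (yα ∷∉ []∉) onto))))
  familyB′-minimal (suc (suc (suc (suc (suc zero))))) = put (put (pop₁ (yx ∷∉ yα ∷∉ yx ∷∉ y∉) (yα ∷∉ []∉)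
    (put (lock {us = t ∷ []} x∉ (xα ∷∉ []∉) (xα ∷∉ []∉) onto))))
  familyB′-minimal (suc (suc (suc (suc (suc (suc i)))))) =
    put (put (put (lock {us = t ∷ []} (xy ∷∉ (x∉ ∘ ∈-removeAt⁻ (descent n) i)) (xα ∷∉ []∉) (xy ∷∉ xα ∷∉ []∉)
      (descend-removed₂ y yα k i))))

  familyC-minimal : (i : Fin (length (family fC n))) → Sorts (removeAt (family fC n) i) []
  familyC-minimal zero = put (put (put (put (pop₁ ((λ ()) ∷∉ (λ ()) ∷∉ z∉) ((λ ()) ∷∉ zα ∷∉ (λ ()) ∷∉ []∉)
    (put (pop₂ (yx ∷∉ y∉) (yα ∷∉ yx ∷∉ []∉) (descend-removed₃ x xα k)))))))
  familyC-minimal (suc zero) = put (put (put (put (pop₁ ((λ ()) ∷∉ (λ ()) ∷∉ z∉) ((λ ()) ∷∉ zα ∷∉ zα ∷∉ []∉)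
    (put (pop₂ (yx ∷∉ y∉) (yα ∷∉ yα ∷∉ []∉) (put (pop₁ x∉ (xα ∷∉ xα ∷∉ []∉) onto))))))))
  familyC-minimal (suc (suc zero)) = put (put (put (put (pop₁ ((λ ()) ∷∉ (λ ()) ∷∉ z∉) ((λ ()) ∷∉ (λ ()) ∷∉ zα ∷∉ []∉)
    (put (pop₂ (yx ∷∉ y∉) (yx ∷∉ yα ∷∉ []∉) (put (pop₂ x∉ (xα ∷∉ []∉) bare))))))))
  familyC-minimal (suc (suc (suc zero))) = put (put (lock {us = t ∷ z ∷ y ∷ []} x∉ (xα ∷∉ (λ ()) ∷∉ xy ∷∉ []∉) (xα ∷∉ []∉)
    (pop₁ y∉ ((λ ()) ∷∉ yα ∷∉ yα ∷∉ []∉) (pop₁ z∉ (zα ∷∉ zα ∷∉ []∉) onto))))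
  familyC-minimal (suc (suc (suc (suc zero)))) = put (put (lock {us = t ∷ y ∷ y ∷ []} x∉ (xα ∷∉ xy ∷∉ xy ∷∉ []∉) (xα ∷∉ []∉)
    (pop₂ y∉ (yα ∷∉ yα ∷∉ []∉) onto)))
  familyC-minimal (suc (suc (suc (suc (suc zero))))) =
      put (put (lock {us = t ∷ y ∷ z ∷ []} x∉ (xα ∷∉ xy ∷∉ (λ ()) ∷∉ []∉) (xα ∷∉ []∉)
    (pop₁ z∉ ((λ ()) ∷∉ zα ∷∉ zα ∷∉ []∉) (pop₁ y∉ (yα ∷∉ yα ∷∉ []∉) onto))))
  familyC-minimal (suc (suc (suc (suc (suc (suc zero)))))) = put (put (pop₁ (xα ∷∉ xy ∷∉ (λ ()) ∷∉ xy ∷∉ x∉) (xα ∷∉ []∉)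
    (put (put (put (pop₁ ((λ ()) ∷∉ z∉) ((λ ()) ∷∉ zα ∷∉ zα ∷∉ []∉) (put (pop₂ y∉ (yα ∷∉ yα ∷∉ []∉) onto))))))))
  familyC-minimal (suc (suc (suc (suc (suc (suc (suc i))))))) =
    put (put (put (put (put (pop₁ ((λ ()) ∷∉ (λ ()) ∷∉ (z∉ ∘ removed)) ((λ ()) ∷∉ zα ∷∉ (λ ()) ∷∉ zα ∷∉ []∉)
      (put (pop₂ (yx ∷∉ (y∉ ∘ removed)) (yα ∷∉ yx ∷∉ yα ∷∉ []∉) (descend-removed₂ x xα k i))))))))
    where
    removed : ∀ {p} → p ∈ removeAt (descent n) i → p ∈ descent n
    removed = ∈-removeAt⁻ (descent n) i

family-minimal : ∀ F k → least F ≤ k →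
    (i : Fin (length (family F (suc (suc k))))) → FootSortable (removeAt (family F (suc (suc k))) i)
family-minimal fA k _ i = Sorts⇒FootSortable (familyA-minimal k i)
family-minimal fB (suc k) _ i = Sorts⇒FootSortable (familyB-minimal k i)
family-minimal fB′ (suc k) _ i = Sorts⇒FootSortable (familyB′-minimal k i)
family-minimal fC (suc k) _ i = Sorts⇒FootSortable (familyC-minimal k i)

-- The characterization

⊆-proper : {w s : List C} → w ⊆ s → w ≡ s ⊎ ∃[ i ] w ⊆ removeAt s i
⊆-proper [] = inj₁ refl
⊆-proper (_ ∷ʳ τ) = inj₂ (zero , τ)
⊆-proper (refl ∷ τ) with ⊆-proper τ
... | inj₁ refl = inj₁ refl
... | inj₂ (i , υ) = inj₂ (suc i , refl ∷ υ)

double≢ : ∀ (l : List C) {p r} → l ++ p ∷ r ≢ l ++ p ∷ p ∷ r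
double≢ [] {r = []} ()
double≢ [] {r = _ ∷ r} ()
double≢ (_ ∷ l) eq = double≢ l (∷-injectiveʳ eq)

removeAt-map : (h : B → C) (w : List B) (i : Fin (length (map h w))) → ∃[ j ] removeAt (map h w) i ≡ map h (removeAt w j)
removeAt-map h (p ∷ w) zero = zero , refl
removeAt-map h (p ∷ w) (suc i) with removeAt-map h w i
... | j , eq = suc j , cong (h p ∷_) eq

Any-lookup : ∀ {A : Set} {P : A → Set ℓ} {n} {xs : Vec A n} → Any P xs → ∃[ j ] P (lookup xs j)
Any-lookup (VecAny.here pj) = zero , pj
Any-lookup (VecAny.there any) with Any-lookup any
... | j , pj = suc j , pj

Renamed-minimal : {w : List B} {s : List C} → NoTriple w → MinimalNonFootSortable w → w RenamesTo s →
  NoTriple s × MinimalNonFootSortable s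
Renamed-minimal {w = w} nt (unsortable , minimal) (h , inj , refl) =
  NoTriple-map h inj nt , unsortable ∘ FootSortable-map⁻ h w inj , λ i →
    let j , eq = removeAt-map h w i in
    subst FootSortable (sym eq) (FootSortable-map⁺ h (λ p∈ q∈ → inj (∈-removeAt⁻ w j p∈) (∈-removeAt⁻ w j q∈)) (minimal j))

Listed-minimal : {s : List C} → Listed s → NoTriple s × MinimalNonFootSortable s
Listed-minimal (inj₁ any) with Any-lookup any
... | j , ren = Renamed-minimal (sporadic-NoTriple j) (sporadic-unsortable j , sporadic-minimal j) ren
Listed-minimal (inj₂ (inj₁ (_ , s≤s (s≤s {n = k} k≥) , ren))) =
  Renamed-minimal (family-NoTriple fA k) (family-unsortable fA k k≥ , family-minimal fA k k≥) ren
Listed-minimal (inj₂ (inj₂ (inj₁ (_ , s≤s (s≤s {n = k} k≥) , ren)))) =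
  Renamed-minimal (family-NoTriple fB k) (family-unsortable fB k k≥ , family-minimal fB k k≥) ren
Listed-minimal (inj₂ (inj₂ (inj₂ (inj₁ (_ , s≤s (s≤s {n = k} k≥) , ren))))) =
  Renamed-minimal (family-NoTriple fB′ k) (family-unsortable fB′ k k≥ , family-minimal fB′ k k≥) ren
Listed-minimal (inj₂ (inj₂ (inj₂ (inj₂ (_ , s≤s (s≤s {n = k} k≥) , ren))))) =
  Renamed-minimal (family-NoTriple fC k) (family-unsortable fC k k≥ , family-minimal fC k k≥) ren

module _ {C : Set ℓ} (_≟_ : DecidableEquality C) {s : List C} (nt : NoTriple s) (minimal : MinimalNonFootSortable s) where

  proper-sortable : ∀ {w} → w ⊆ s → w ≢ s → FootSortable w
  proper-sortable τ w≢s with ⊆-proper τ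
  ... | inj₁ w≡s = ⊥-elim (w≢s w≡s)
  ... | inj₂ (i , υ) = FootSortable-⊆ _≟_ υ (proj₂ minimal i)

  -- Otherwise deleting one of the two socks gives a sortable word, and doubling the other one sorts
  -- `s`.
  no-adjacent : ∀ l p r → l ++ p ∷ p ∷ r ≢ s
  no-adjacent l p r refl = proj₁ minimal (FootSortable-double _≟_ {u = l}
    (proper-sortable (++⁺ (⊆-refl {x = l}) (p ∷ʳ ⊆-refl)) (double≢ l)))

  minimal⇒Listed : Listed s
  minimal⇒Listed with Greedy.sortable-or-contains _≟_ nt no-adjacent
  ... | inj₁ sortable = ⊥-elim (proj₁ minimal sortable)
  ... | inj₂ (w , τ , listed) with ⊆-proper τ
  ... | inj₁ refl = listed
  -- A listed word that is a proper part of `s` would be sortable by the minimality of `s`.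
  ... | inj₂ (i , υ) = ⊥-elim (proj₁ (proj₂ (Listed-minimal listed)) (FootSortable-⊆ _≟_ υ (proj₂ minimal i)))

theorem1p1 : ∀ {ℓ : Level} {C : Set ℓ} (_≟_ : DecidableEquality C) (s : List C) →
    (2-Bounded _≟_ s × MinimalNonFootSortable s)
    ⇔
    ( Any (λ w → w RenamesTo s) sporadic
    ⊎ (∃[ n ] n ≥ 2 × familyA n RenamesTo s)
    ⊎ (∃[ n ] n ≥ 3 × familyB n RenamesTo s)
    ⊎ (∃[ n ] n ≥ 3 × familyB′ n RenamesTo s)
    ⊎ (∃[ n ] n ≥ 3 × familyC n RenamesTo s) )
theorem1p1 _≟_ s = mk⇔
  (λ (bounded , minimal) → minimal⇒Listed _≟_ (2-Bounded⇒NoTriple _≟_ bounded) minimal)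
  (λ listed → let nt , minimal = Listed-minimal listed in NoTriple⇒2-Bounded _≟_ nt , minimal)
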